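{- Let $n\ge 3$, let $\mathbb T$ be a triangulation of a convex $n$-gon, let $i\in\mathbb Z$, and consider the base edge $v_{i-1}v_i$. Let $\{\zeta_{k,\ell}\}_{0\le \ell-k\le n+1}$ be the $q$-deformed Conway--Coxeter frieze of $\mathbb T$ and let $(r_{i,u},s_{i,u})_{u\in\mathbb Z}$ be the numerators and denominators of the anti-periodic extension of the $q$-Farey labeling of $(\mathbb T,i)$. Define $\ell_{i,j}$ for $i-1\le j\le i+n-1$ by $$\ell_{i,i-1}=0,\qquad \ell_{i,j}-\ell_{i,j-1}=\mu_{i,j}\quad(i\le j\le i+n-1),$$ where $\mu_{i,j}$ is the descendant degree of $v_j$. Then for every $j\in\mathbb Z$ with $i-1\le j\le i+n-1$, $$\zeta_{i-1,j+1}=q^{\ell_{i,j}}\,r_{i,j+1},\qquad \zeta_{i,j+1}=q^{\ell_{i,j}}\,s_{i,j+1}.$$ In particular, $\ell_{i,i}=\ell_{i,i+1}=0$, since $\mu_{i,i}=\mu_{i,i+1}=0$.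
   Context: Triangulations. Let $n\ge3$ and let $\mathcal P$ be a convex $n$-gon with vertices numbered clockwise $v_0,\dots,v_{n-1}$; indices are extended to $\mathbb Z$ by $v_{u+n}=v_u$. A triangulation $\mathbb T$ of $\mathcal P$ is a triangulation by $n-3$ non-crossing diagonals; its triangles are called cells. Let $c_u$ be the number of cells having $v_u$ as a vertex; the $n$-periodic sequence $(c_u)_{u\in\mathbb Z}$ is the quiddity of $\mathbb T$. $q$-deformed Conway--Coxeter frieze ($q$-CCF) of $\mathbb T$. For an integer $a\ge0$ put $[a]_q=1+q+\cdots+q^{a-1}$ (with $[0]_q=0$). The $q$-CCF is the array of polynomials $\zeta_{k,\ell}\in\mathbb Z[q]$, for integers $k,\ell$ with $0\le \ell-k\le n+1$, determined by $\zeta_{k,k}=0$, $\zeta_{k,k+1}=1$, $\zeta_{k,k+2}=[c_{k+1}]_q$ and, recursively for $\ell-k\ge3$, by the $q$-unimodular rule $$\zeta_{k,\ell-1}\zeta_{k+1,\ell}-\zeta_{k+1,\ell-1}\zeta_{k,\ell}=q^{\sum_{u=k+1}^{\ell-2}(c_u-1)}.$$ (In this range the divisors $\zeta_{k+1,\ell-1}$ are nonzero and the array is well defined with values in $\mathbb Z[q]$.) $q$-Farey labeling of $(\mathbb T,i)$. The base edge is $v_{i-1}v_i=v_{i+n-1}v_i$. Represent vertices by indices in $\{i,i+1,\dots,i+n-1\}$. Each cell is then uniquely $\{v_a,v_b,v_g\}$ with $i\le b<g<a\le i+n-1$ (clockwise order $v_a,v_b,v_g$); its base side is $v_av_b$ (the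 base edge itself for the cell containing the base edge; otherwise the side separating the cell from the base edge). Assign weights (powers of $q$) to sides and pairs $(r_{i,j},s_{i,j})\in\mathbb Z[q]^2$, $i\le j\le i+n-1$, to vertices as follows, starting from the base edge and proceeding from each cell to its neighbours away from the base edge. The base edge has weight $q^{ -1}$, and $(r_{i,i+n-1},s_{i,i+n-1})=(0,1)$, $(r_{i,i},s_{i,i})=(1,0)$. If a cell with indices $b<g<a$ has base side $v_av_b$ of weight $q^{\ell-1}$, then $$r_{i,g}=r_{i,a}+q^{\ell}r_{i,b},\qquad s_{i,g}=s_{i,a}+q^{\ell}s_{i,b},$$ the side $v_gv_a$ gets weight $1$ and the side $v_bv_g$ gets weight $q^{\ell}$. The label of $v_j$ is $\theta_{i,j}=r_{i,j}/s_{i,j}$ (fractions are not reduced; $r_{i,j},s_{i,j}$ are the polynomials just defined). The anti-periodic extension is given by $r_{i,j+tn}=(-1)^tr_{i,j}$, $s_{i,j+tn}=(-1)^ts_{i,j}$ for $i\le j\le i+n-1$, $t\in\mathbb Z$. Descendant degree. For $i\le j\le i+n-1$, $\mu_{i,j}$ is the number of diagonals of $\mathbb T$ joining $v_j$ to a vertex $v_\alpha$ with $i\le\alpha\le j-2$. (Equivalently, if the cells at $v_j$ are numbered counterclockwise around $v_j$ as $\mathcal C_0,\mathcal C_1,\dots,\mathcal C_{c_j-1}$ starting from the one containing the edge $v_{j-1}v_j$, then $\mathcal C_{\mu_{i,j}}$ is the one with the fewest ancestors, i.e. separated from the base edge by the fewest diagonals.) -}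

module Defs where

open import Data.Nat.Base as ℕ using (ℕ; zero; suc; NonZero)
open import Data.Integer.Base as ℤ using (ℤ; +_; 0ℤ; 1ℤ; -1ℤ; _+_; _-_; _*_; _≤_; _<_; _⊔_; ∣_∣)
open import Data.Nat.ListAction using (sum)
open import Data.Integer.DivMod using (n%ℕd<d)
open import Data.Fin.Base as Fin using (Fin; fromℕ<; toℕ)
import Data.Fin.Properties as Fin
open import Data.List.Base using (List; []; _∷_; _++_; map; replicate; filter; length; upTo; allFin; cartesianProduct)
open import Data.List.Membership.Propositional using (_∈_)
open import Data.List.Relation.Unary.Any using (any?)
open import Data.List.Relation.Unary.All using (All)
open import Data.List.Relation.Unary.Unique.Propositional using (Unique)
open import Data.Product.Base using (_×_; _,_)
open import Data.Product.Properties using (≡-dec)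
open import Data.Sum.Base using (_⊎_)
open import Relation.Nullary using (¬_; Dec; _×-dec_; _⊎-dec_)
open import Relation.Unary using (Decidable)
open import Relation.Binary.PropositionalEquality using (_≡_)

-- The polynomial ring ℤ[q]: a list holds the coefficients of 1, q, q², …,
-- and trailing zeros are insignificant, so equality is _≈_, not _≡_.

Poly : Set
Poly = List ℤ

coeff : Poly → ℕ → ℤ
coeff []      _       = 0ℤ
coeff (a ∷ _) zero    = a
coeff (_ ∷ p) (suc k) = coeff p k

infix  4 _≈_
infixl 6 _⊕_ _⊖_
infixl 7 _⊗_ _·_
infix  8 q^_

record _≈_ (p p′ : Poly) : Set where
  constructor mk≈
  field
    coeff-≡ : ∀ k → coeff p k ≡ coeff p′ k

0# 1# : Poly
0# = []
1# = 1ℤ ∷ []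

_⊕_ : Poly → Poly → Poly
[]      ⊕ p′       = p′
(a ∷ p) ⊕ []       = a ∷ p
(a ∷ p) ⊕ (b ∷ p′) = (a + b) ∷ (p ⊕ p′)

_·_ : ℤ → Poly → Poly
a · p = map (a *_) p

_⊖_ : Poly → Poly → Poly
p ⊖ p′ = p ⊕ (-1ℤ · p′)

_⊗_ : Poly → Poly → Poly
[]      ⊗ p′ = []
(a ∷ p) ⊗ p′ = (a · p′) ⊕ (0ℤ ∷ (p ⊗ p′))

q^_ : ℕ → Poly
q^ k = replicate k 0ℤ ++ 1#

[_]q : ℕ → Poly
[ a ]q = replicate a 1ℤ

-- The integers x with a ≤ x ≤ b, in increasing order; empty when b < a.
[_⋯_] : ℤ → ℤ → List ℤ
[ a ⋯ b ] = map (λ k → a + + k) (upTo ∣ 0ℤ ⊔ (b - a + 1ℤ) ∣)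

module Polygon (n : ℕ) .{{_ : NonZero n}} where

  -- Fin n is the set of vertices, in clockwise order; v u is the vertex v_u,
  -- with the index u read modulo n.
  v : ℤ → Fin n
  v u = fromℕ< (n%ℕd<d u n)

  next : Fin n → Fin n
  next x = v (+ suc (toℕ x))

  Side : Fin n → Fin n → Set
  Side x y = y ≡ next x ⊎ x ≡ next y

  side? : ∀ x y → Dec (Side x y)
  side? x y = (y Fin.≟ next x) ⊎-dec (x Fin.≟ next y)

-- A diagonal is stored once, as the pair of its endpoints in increasing order.
record Triangulation (n : ℕ) .{{_ : NonZero n}} : Set where
  open Polygon n

  field
    diagonals : List (Fin n × Fin n)

  Diagonal : Fin n → Fin n → Set
  Diagonal x y = (x , y) ∈ diagonals ⊎ (y , x) ∈ diagonals

  field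
    proper      : All (λ (x , y) → x Fin.< y × ¬ Side x y) diagonals
    unique      : Unique diagonals
    count       : length diagonals ≡ n ℕ.∸ 3
    -- v_a, v_b, v_c, v_d are distinct and in this cyclic order exactly when,
    -- for suitable representatives, a < b < c < d < a + n.
    nonCrossing : ∀ a b c d → a < b → b < c → c < d → d < a + + n →
                  Diagonal (v a) (v c) → ¬ Diagonal (v b) (v d)

  diagonal? : ∀ x y → Dec (Diagonal x y)
  diagonal? x y = any? (≡-dec Fin._≟_ Fin._≟_ (x , y)) diagonals
           ⊎-dec any? (≡-dec Fin._≟_ Fin._≟_ (y , x)) diagonals

  Joined : Fin n → Fin n → Set
  Joined x y = Side x y ⊎ Diagonal x y

  joined? : ∀ x y → Dec (Joined x y)
  joined? x y = side? x y ⊎-dec diagonal? x y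

  -- Three vertices span a cell when each of the three segments between them
  -- is a side of the polygon or a diagonal of the triangulation: nothing can
  -- then subdivide the triangle, all vertices of the polygon being extremal.
  Cell : Fin n → Fin n → Fin n → Set
  Cell x y z = Joined x y × Joined y z × Joined x z

  -- Each cell once, its vertices in increasing order.
  cells : List (Fin n × Fin n × Fin n)
  cells = filter increasingCell?
            (cartesianProduct (allFin n) (cartesianProduct (allFin n) (allFin n)))
    where
    increasingCell? : Decidable (λ ((x , y , z) : Fin n × Fin n × Fin n) →
                                   (x Fin.< y × y Fin.< z) × Cell x y z)
    increasingCell? (x , y , z) =
      (x Fin.<? y ×-dec y Fin.<? z) ×-dec
      (joined? x y ×-dec joined? y z ×-dec joined? x z)

  quiddity : ℤ → ℕ
  quiddity u = length (filter hasVertex? cells)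
    where
    hasVertex? : Decidable (λ ((x , y , z) : Fin n × Fin n × Fin n) →
                              v u ≡ x ⊎ v u ≡ y ⊎ v u ≡ z)
    hasVertex? (x , y , z) = (v u Fin.≟ x) ⊎-dec (v u Fin.≟ y) ⊎-dec (v u Fin.≟ z)

  descendantDegree : ℤ → ℤ → ℕ
  descendantDegree i j =
    length (filter (λ α → diagonal? (v j) (v α)) [ i ⋯ j - + 2 ])

module _ {n : ℕ} .{{_ : NonZero n}} (𝕋 : Triangulation n) where
  open Polygon n
  open Triangulation 𝕋

  -- ζ k ℓ is only constrained for 0 ≤ ℓ - k ≤ n + 1. The truncated
  -- subtraction is harmless: every vertex lies in at least one cell.
  record IsFrieze (ζ : ℤ → ℤ → Poly) : Set where
    field
      row₀ : ∀ k → ζ k k ≈ 0#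
      row₁ : ∀ k → ζ k (k + 1ℤ) ≈ 1#
      row₂ : ∀ k → ζ k (k + + 2) ≈ [ quiddity (k + 1ℤ) ]q
      unimodular : ∀ k ℓ → k + + 3 ≤ ℓ → ℓ ≤ k + + n + 1ℤ →
        ζ k (ℓ - 1ℤ) ⊗ ζ (k + 1ℤ) ℓ ⊖ ζ (k + 1ℤ) (ℓ - 1ℤ) ⊗ ζ k ℓ
          ≈ q^ sum (map (λ u → quiddity u ℕ.∸ 1) [ k + 1ℤ ⋯ ℓ - + 2 ])

  -- r j and s j are r_{i,j} and s_{i,j}. For i ≤ b < a ≤ i + n - 1, the segment
  -- joining v_b and v_a, when it is a side of some cell, has weight q^(w b a);
  -- as the base edge has weight q⁻¹, the exponent w b a is an integer.
  record IsFareyLabeling (i : ℤ) (w : ℤ → ℤ → ℤ) (r s : ℤ → Poly) : Set where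
    private
      last : ℤ
      last = i + + n - 1ℤ
    field
      base-weight : w i last ≡ -1ℤ
      r-last      : r last ≈ 0#
      s-last      : s last ≈ 1#
      r-first     : r i ≈ 1#
      s-first     : s i ≈ 0#
      -- The base side of a cell with indices b < g < a is v_a v_b.
      cell : ∀ b g a (ℓ : ℕ) → i ≤ b → b < g → g < a → a ≤ last →
        Cell (v b) (v g) (v a) → w b a ≡ + ℓ - 1ℤ →
          r g ≈ r a ⊕ q^ ℓ ⊗ r b
        × s g ≈ s a ⊕ q^ ℓ ⊗ s b
        × w g a ≡ 0ℤ
        × w b g ≡ + ℓ
      antiperiodic : ∀ j (t : ℤ) → i ≤ j → j ≤ last →
          r (j + t * + n) ≈ (-1ℤ ℤ.^ ∣ t ∣) · r j
        × s (j + t * + n) ≈ (-1ℤ ℤ.^ ∣ t ∣) · s j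

  record IsDegreeSum (i : ℤ) (ℓ : ℤ → ℕ) : Set where
    field
      start : ℓ (i - 1ℤ) ≡ 0
      step  : ∀ j → i ≤ j → j ≤ i + + n - 1ℤ →
              ℓ j ≡ ℓ (j - 1ℤ) ℕ.+ descendantDegree i j

{-# OPTIONS --safe #-}
module Submission where

-- The frieze is computed by signed continuants: the unimodular rule determines it as long as
-- one may divide by ζ_{k+1,ℓ-1}, and the continuants given by the three-term recurrence
--   Z_{k,ℓ+1} + q^(c_{ℓ-1}-1) Z_{k,ℓ-1} = [c_ℓ] Z_{k,ℓ}
-- satisfy the same rule.  Going once around the fan of cells at v_j, the Farey labels satisfy
--   q^μ_j r_{j+1} + q^(c_{j-1}-1-μ_{j-1}) r_{j-1} = [c_j] r_j,
-- because q^(c_{j-1}-1-μ_{j-1}) is the weight of the side v_{j-1}v_j, so q^ℓ_{j-1} r_j obeys the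
-- recurrence of the continuants.  All denominators s_j have constant term 1; applied to a Farey
-- labelling constructed at each base edge this shows that the continuants are not zero divisors.
-- The cells exist because a set of n − 3 non-crossing diagonals is maximal.

open import Defs
open import Level using (0ℓ)
open import Data.Nat.Base as ℕ using (ℕ; zero; suc; NonZero; z≤n; s≤s)
import Data.Nat.Properties as ℕ
open import Data.Nat.Induction using (<-wellFounded)
open import Data.Nat.ListAction using (sum)
open import Data.Nat.ListAction.Properties using (sum-++)
open import Data.Integer.Base as ℤ using (ℤ; +_; 0ℤ; 1ℤ; -1ℤ; _+_; _-_; _*_; -_; ∣_∣; _%ℕ_; _/ℕ_; _≤_; _⊔_)
import Data.Integer.Properties as ℤ
import Data.Integer.Tactic.RingSolver as ℤSolver
open import Data.Integer.DivMod using (n%ℕd<d; a≡a%ℕn+[a/ℕn]*n)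
open import Data.Fin.Base as Fin using (Fin; toℕ)
import Data.Fin.Properties as Fin
open import Data.List.Base using (List; []; _∷_; _++_; map; applyUpTo; upTo; filter; length; lookup; cartesianProduct; allFin)
open import Data.List.Properties using (length-applyUpTo; length-map; map-upTo; upTo-∷ʳ; map-++; map-∘; map-cong)
open import Data.List.Membership.Propositional using (_∈_)
open import Data.List.Membership.Propositional.Properties
  using (∈-lookup; ∈-map⁻; ∈-applyUpTo⁺; ∈-applyUpTo⁻; ∈-filter⁺; ∈-filter⁻; ∈-cartesianProduct⁺; ∈-allFin)
open import Data.List.Relation.Unary.Any as Any using (here; there)
import Data.List.Relation.Unary.Any.Properties as Any
open import Data.List.Relation.Unary.All as All using (All; []; _∷_)
open import Data.List.Relation.Unary.AllPairs using ([]; _∷_)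
open import Data.List.Relation.Unary.Unique.Propositional using (Unique)
import Data.List.Relation.Unary.Unique.Propositional.Properties as Unique
open import Data.Product.Base using (_×_; _,_; ∃; ∃₂; proj₁; proj₂)
open import Data.Product.Properties using (,-injective)
open import Data.Sum.Base as Sum using (_⊎_; inj₁; inj₂; [_,_]′; swap)
open import Data.Empty using (⊥; ⊥-elim)
open import Algebra.Bundles using (CommutativeRing)
open import Function.Base using (_∘_)
open import Induction.WellFounded using (Acc; acc)
open import Relation.Binary using (tri<; tri≈; tri>)
open import Relation.Binary.Bundles using (Setoid)
open import Relation.Binary.PropositionalEquality
  using (_≡_; _≢_; refl; sym; trans; cong; cong₂; subst; subst₂; module ≡-Reasoning)
open import Relation.Nullary using (¬_; Dec; yes; no; _×-dec_; _⊎-dec_)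
open import Relation.Unary using (Decidable)
open _≈_

-- The hypotheses give one labelling, at `i`, while the induction on the rows of the frieze divides
-- by entries starting at every `k`. This is why a labelling is built at each base edge. The built
-- labelling covers a single turn of the polygon: the divisors lie in rows 1 to n - 1, exactly the
-- rows reached by the relations at inner vertices. Antiperiodicity enters only at the last vertex,
-- where `r_{i+n} = −r_i` cancels the term of the fan lying on the base edge. The fan at `v_j` is
-- cut at its cell with fewest ancestors. On one side of that cell each further cell multiplies the
-- weight of the next side by q; on the other side every further cell restarts from weight 1. Both
-- sides give geometric sums, and together with the cut cell they add up to `[c_j]`. Scaling by
-- `q^ℓ` works because `c_j − 1` is the sum of `μ_j`, the increment of `ℓ`, and the exponent of the
-- side `v_j v_{j+1}`. Denominators start with the values 0, 1 at `v_i`; numerators start with 1 at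
-- `v_i`, hence are continuants begun at `v_{i-1}`.

private module ≡ = ≡-Reasoning

-- The commutative ring ℤ[q].

≈-refl : ∀ {p} → p ≈ p
≈-refl = mk≈ λ _ → refl

≈-sym : ∀ {p r} → p ≈ r → r ≈ p
≈-sym e = mk≈ λ k → sym (coeff-≡ e k)

≈-trans : ∀ {p r t} → p ≈ r → r ≈ t → p ≈ t
≈-trans e e′ = mk≈ λ k → trans (coeff-≡ e k) (coeff-≡ e′ k)

≈-reflexive : ∀ {p r} → p ≡ r → p ≈ r
≈-reflexive refl = ≈-refl

polySetoid : Setoid 0ℓ 0ℓ
polySetoid = record
  { Carrier = Poly ; _≈_ = _≈_
  ; isEquivalence = record { refl = ≈-refl ; sym = ≈-sym ; trans = ≈-trans } }

coeff-⊕ : ∀ p r k → coeff (p ⊕ r) k ≡ coeff p k + coeff r k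
coeff-⊕ []      r       k       = sym (ℤ.+-identityˡ _)
coeff-⊕ (a ∷ p) []      k       = sym (ℤ.+-identityʳ _)
coeff-⊕ (a ∷ p) (b ∷ r) zero    = refl
coeff-⊕ (a ∷ p) (b ∷ r) (suc k) = coeff-⊕ p r k

coeff-· : ∀ a p k → coeff (a · p) k ≡ a * coeff p k
coeff-· a []      k       = sym (ℤ.*-zeroʳ a)
coeff-· a (b ∷ p) zero    = refl
coeff-· a (b ∷ p) (suc k) = coeff-· a p k

∷-cong : ∀ {a b p r} → a ≡ b → p ≈ r → a ∷ p ≈ b ∷ r
∷-cong e e′ = mk≈ λ { zero → e ; (suc k) → coeff-≡ e′ k }

∷-tail : ∀ {a b p r} → a ∷ p ≈ b ∷ r → p ≈ r
∷-tail e = mk≈ λ k → coeff-≡ e (suc k)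

0∷[]≈[] : 0ℤ ∷ [] ≈ []
0∷[]≈[] = mk≈ λ { zero → refl ; (suc k) → refl }

⊕-cong : ∀ {p p′ r r′} → p ≈ p′ → r ≈ r′ → p ⊕ r ≈ p′ ⊕ r′
⊕-cong {p} {p′} {r} {r′} e e′ = mk≈ λ k → ≡.begin
  coeff (p ⊕ r) k           ≡.≡⟨ coeff-⊕ p r k ⟩
  coeff p k + coeff r k     ≡.≡⟨ cong₂ _+_ (coeff-≡ e k) (coeff-≡ e′ k) ⟩
  coeff p′ k + coeff r′ k   ≡.≡⟨ coeff-⊕ p′ r′ k ⟨
  coeff (p′ ⊕ r′) k         ≡.∎

⊕-comm : ∀ p r → p ⊕ r ≈ r ⊕ p
⊕-comm p r = mk≈ λ k → ≡.begin
  coeff (p ⊕ r) k         ≡.≡⟨ coeff-⊕ p r k ⟩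
  coeff p k + coeff r k   ≡.≡⟨ ℤ.+-comm (coeff p k) (coeff r k) ⟩
  coeff r k + coeff p k   ≡.≡⟨ coeff-⊕ r p k ⟨
  coeff (r ⊕ p) k         ≡.∎

⊕-assoc : ∀ p r t → (p ⊕ r) ⊕ t ≈ p ⊕ (r ⊕ t)
⊕-assoc p r t = mk≈ λ k → ≡.begin
  coeff ((p ⊕ r) ⊕ t) k                 ≡.≡⟨ coeff-⊕ (p ⊕ r) t k ⟩
  coeff (p ⊕ r) k + coeff t k           ≡.≡⟨ cong (_+ coeff t k) (coeff-⊕ p r k) ⟩
  coeff p k + coeff r k + coeff t k     ≡.≡⟨ ℤ.+-assoc (coeff p k) (coeff r k) (coeff t k) ⟩
  coeff p k + (coeff r k + coeff t k)   ≡.≡⟨ cong (_+_ (coeff p k)) (coeff-⊕ r t k) ⟨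
  coeff p k + coeff (r ⊕ t) k           ≡.≡⟨ coeff-⊕ p (r ⊕ t) k ⟨
  coeff (p ⊕ (r ⊕ t)) k                 ≡.∎

⊕-identityʳ : ∀ p → p ⊕ [] ≈ p
⊕-identityʳ p = ⊕-comm p []

⊕-inverseʳ : ∀ p → p ⊕ -1ℤ · p ≈ []
⊕-inverseʳ p = mk≈ λ k → ≡.begin
  coeff (p ⊕ -1ℤ · p) k               ≡.≡⟨ coeff-⊕ p (-1ℤ · p) k ⟩
  coeff p k + coeff (-1ℤ · p) k       ≡.≡⟨ cong (_+_ (coeff p k)) (coeff-· -1ℤ p k) ⟩
  coeff p k + -1ℤ * coeff p k         ≡.≡⟨ cong (_+_ (coeff p k)) (ℤ.-1*i≡-i (coeff p k)) ⟩
  coeff p k + ℤ.- coeff p k           ≡.≡⟨ ℤ.+-inverseʳ (coeff p k) ⟩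
  0ℤ                                  ≡.∎

·-cong : ∀ a {p r} → p ≈ r → a · p ≈ a · r
·-cong a {p} {r} e = mk≈ λ k → trans (coeff-· a p k) (trans (cong (a *_) (coeff-≡ e k)) (sym (coeff-· a r k)))

·-distribˡ : ∀ a p r → a · (p ⊕ r) ≈ a · p ⊕ a · r
·-distribˡ a p r = mk≈ λ k → ≡.begin
  coeff (a · (p ⊕ r)) k                 ≡.≡⟨ coeff-· a (p ⊕ r) k ⟩
  a * coeff (p ⊕ r) k                   ≡.≡⟨ cong (a *_) (coeff-⊕ p r k) ⟩
  a * (coeff p k + coeff r k)           ≡.≡⟨ ℤ.*-distribˡ-+ a (coeff p k) (coeff r k) ⟩
  a * coeff p k + a * coeff r k         ≡.≡⟨ cong₂ _+_ (coeff-· a p k) (coeff-· a r k) ⟨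
  coeff (a · p) k + coeff (a · r) k     ≡.≡⟨ coeff-⊕ (a · p) (a · r) k ⟨
  coeff (a · p ⊕ a · r) k               ≡.∎

·-assoc : ∀ a b p → a · (b · p) ≈ (a * b) · p
·-assoc a b p = mk≈ λ k → ≡.begin
  coeff (a · (b · p)) k   ≡.≡⟨ coeff-· a (b · p) k ⟩
  a * coeff (b · p) k     ≡.≡⟨ cong (a *_) (coeff-· b p k) ⟩
  a * (b * coeff p k)     ≡.≡⟨ ℤ.*-assoc a b (coeff p k) ⟨
  a * b * coeff p k       ≡.≡⟨ coeff-· (a * b) p k ⟨
  coeff ((a * b) · p) k   ≡.∎

0·p≈[] : ∀ p → 0ℤ · p ≈ []
0·p≈[] p = mk≈ λ k → trans (coeff-· 0ℤ p k) (ℤ.*-zeroˡ (coeff p k))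

1·p≈p : ∀ p → 1ℤ · p ≈ p
1·p≈p p = mk≈ λ k → trans (coeff-· 1ℤ p k) (ℤ.*-identityˡ (coeff p k))

⊕-swap : ∀ p r t → p ⊕ (r ⊕ t) ≈ r ⊕ (p ⊕ t)
⊕-swap p r t = ≈-trans (≈-sym (⊕-assoc p r t)) (≈-trans (⊕-cong (⊕-comm p r) ≈-refl) (⊕-assoc r p t))

⊕-interchange : ∀ p p′ r r′ → (p ⊕ p′) ⊕ (r ⊕ r′) ≈ (p ⊕ r) ⊕ (p′ ⊕ r′)
⊕-interchange p p′ r r′ = ≈-trans (⊕-assoc p p′ (r ⊕ r′))
  (≈-trans (⊕-cong (≈-refl {p}) (⊕-swap p′ r r′)) (≈-sym (⊕-assoc p r (p′ ⊕ r′))))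

⊗-congʳ : ∀ p {r t} → r ≈ t → p ⊗ r ≈ p ⊗ t
⊗-congʳ []      e = ≈-refl
⊗-congʳ (a ∷ p) e = ⊕-cong (·-cong a e) (∷-cong refl (⊗-congʳ p e))

⊗-zeroʳ : ∀ p → p ⊗ [] ≈ []
⊗-zeroʳ []      = ≈-refl
⊗-zeroʳ (a ∷ p) = ≈-trans (∷-cong refl (⊗-zeroʳ p)) 0∷[]≈[]

⊗-∷ʳ : ∀ p b r → p ⊗ (b ∷ r) ≈ b · p ⊕ (0ℤ ∷ p ⊗ r)
⊗-∷ʳ []      b r = ≈-sym 0∷[]≈[]
⊗-∷ʳ (a ∷ p) b r = ∷-cong (cong (_+ 0ℤ) (ℤ.*-comm a b))
  (≈-trans (⊕-cong ≈-refl (⊗-∷ʳ p b r)) (⊕-swap (a · r) (b · p) _))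

⊗-comm : ∀ p r → p ⊗ r ≈ r ⊗ p
⊗-comm []      r = ≈-sym (⊗-zeroʳ r)
⊗-comm (a ∷ p) r = ≈-trans (⊕-cong ≈-refl (∷-cong refl (⊗-comm p r))) (≈-sym (⊗-∷ʳ r a p))

⊗-cong : ∀ {p p′ r r′} → p ≈ p′ → r ≈ r′ → p ⊗ r ≈ p′ ⊗ r′
⊗-cong {p} {p′} {r} {r′} e e′ = ≈-trans (⊗-congʳ p e′)
  (≈-trans (⊗-comm p r′) (≈-trans (⊗-congʳ r′ e) (⊗-comm r′ p′)))

⊗-distribˡ : ∀ p r t → p ⊗ (r ⊕ t) ≈ p ⊗ r ⊕ p ⊗ t
⊗-distribˡ []      r t = ≈-refl
⊗-distribˡ (a ∷ p) r t = ≈-trans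
  (⊕-cong (·-distribˡ a r t) (∷-cong refl (⊗-distribˡ p r t)))
  (⊕-interchange (a · r) (a · t) (0ℤ ∷ p ⊗ r) (0ℤ ∷ p ⊗ t))

⊗-distribʳ : ∀ t p r → (p ⊕ r) ⊗ t ≈ p ⊗ t ⊕ r ⊗ t
⊗-distribʳ t p r = ≈-trans (⊗-comm (p ⊕ r) t)
  (≈-trans (⊗-distribˡ t p r) (⊕-cong (⊗-comm t p) (⊗-comm t r)))

·-⊗ : ∀ a p r → (a · p) ⊗ r ≈ a · (p ⊗ r)
·-⊗ a []      r = ≈-refl
·-⊗ a (b ∷ p) r = ≈-trans
  (⊕-cong (≈-sym (·-assoc a b r)) (∷-cong (sym (ℤ.*-zeroʳ a)) (·-⊗ a p r)))
  (≈-sym (·-distribˡ a (b · r) (0ℤ ∷ p ⊗ r)))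

0∷-⊗ : ∀ p r → (0ℤ ∷ p) ⊗ r ≈ 0ℤ ∷ p ⊗ r
0∷-⊗ p r = ⊕-cong (0·p≈[] r) ≈-refl

⊗-assoc : ∀ p r t → (p ⊗ r) ⊗ t ≈ p ⊗ (r ⊗ t)
⊗-assoc []      r t = ≈-refl
⊗-assoc (a ∷ p) r t = ≈-trans (⊗-distribʳ t (a · r) (0ℤ ∷ p ⊗ r))
  (⊕-cong (·-⊗ a r t) (≈-trans (0∷-⊗ (p ⊗ r) t) (∷-cong refl (⊗-assoc p r t))))

⊗-identityˡ : ∀ p → 1# ⊗ p ≈ p
⊗-identityˡ p = ≈-trans (⊕-cong (1·p≈p p) 0∷[]≈[]) (⊕-identityʳ p)

-- Negation is `-1ℤ ·_`, so that `_⊖_` is definitionally the subtraction of this ring and the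
-- general laws of rings and groups apply to it.
polyRing : CommutativeRing 0ℓ 0ℓ
polyRing = record
  { Carrier = Poly ; _≈_ = _≈_ ; _+_ = _⊕_ ; _*_ = _⊗_ ; -_ = -1ℤ ·_ ; 0# = 0# ; 1# = 1#
  ; isCommutativeRing = record
    { isRing = record
      { +-isAbelianGroup = record
        { isGroup = record
          { isMonoid = record
            { isSemigroup = record
              { isMagma = record { isEquivalence = Setoid.isEquivalence polySetoid ; ∙-cong = ⊕-cong }
              ; assoc = ⊕-assoc }
            ; identity = (λ _ → ≈-refl) , ⊕-identityʳ }
          ; inverse = (λ p → ≈-trans (⊕-comm (-1ℤ · p) p) (⊕-inverseʳ p)) , ⊕-inverseʳ
          ; ⁻¹-cong = ·-cong -1ℤ }
        ; comm = ⊕-comm }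
      ; *-cong = ⊗-cong
      ; *-assoc = ⊗-assoc
      ; *-identity = ⊗-identityˡ , λ p → ≈-trans (⊗-comm p 1#) (⊗-identityˡ p)
      ; distrib = ⊗-distribˡ , ⊗-distribʳ }
    ; *-comm = ⊗-comm } }

q^-+ : ∀ k m → q^ (k ℕ.+ m) ≈ q^ k ⊗ q^ m
q^-+ zero    m = ≈-sym (⊗-identityˡ (q^ m))
q^-+ (suc k) m = ≈-trans (∷-cong refl (q^-+ k m)) (≈-sym (0∷-⊗ (q^ k) (q^ m)))

[]q-+ : ∀ k m → [ k ℕ.+ m ]q ≈ [ k ]q ⊕ q^ k ⊗ [ m ]q
[]q-+ zero    m = ≈-sym (⊗-identityˡ [ m ]q)
[]q-+ (suc k) m = ≈-trans (∷-cong refl ([]q-+ k m))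
  (≈-sym (⊕-cong (≈-refl {[ suc k ]q}) (0∷-⊗ (q^ k) [ m ]q)))

open import Relation.Binary.Reasoning.Setoid polySetoid hiding (start)
open CommutativeRing polyRing using (commutativeSemiring; +-group)
import Algebra.Properties.Ring (CommutativeRing.ring polyRing) as PolyRing
open import Algebra.Properties.Group +-group using (//-rightDividesˡ; x∙y⁻¹≈ε⇒x≈y; x≈y⇒x∙y⁻¹≈ε; ∙-cancelʳ)
open import Algebra.Solver.Ring.NaturalCoefficients.Default commutativeSemiring using (solve; _:+_; _:*_; _:=_; con)

-- Cancellation in ℤ[q].

NonZeroDivisor : Poly → Set
NonZeroDivisor p = ∀ x → p ⊗ x ≈ 0# → x ≈ 0#

nonZeroDivisor-resp : ∀ {p r} → p ≈ r → NonZeroDivisor p → NonZeroDivisor r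
nonZeroDivisor-resp e h x rx≈0 = h x (≈-trans (⊗-cong e (≈-refl {x})) rx≈0)

-- Lowest degree first: the constant term of `p ⊗ (a ∷ x)` is `a`, so `a` vanishes, and what remains
-- is the equation for `x`, shifted by one degree.
nonZeroDivisor-coeff₀ : ∀ p → coeff p 0 ≡ 1ℤ → NonZeroDivisor p
nonZeroDivisor-coeff₀ p p₀ []      _ = ≈-refl
nonZeroDivisor-coeff₀ p p₀ (a ∷ x) e =
  ≈-trans (∷-cong a≡0 (nonZeroDivisor-coeff₀ p p₀ x (∷-tail shifted))) 0∷[]≈[]
  where
  expanded : a · p ⊕ (0ℤ ∷ p ⊗ x) ≈ 0#
  expanded = ≈-trans (≈-sym (⊗-∷ʳ p a x)) e
  a≡0 : a ≡ 0ℤ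
  a≡0 = ≡.begin
    a                                    ≡.≡⟨ ℤ.*-identityʳ a ⟨
    a * 1ℤ                               ≡.≡⟨ cong (a *_) p₀ ⟨
    a * coeff p 0                        ≡.≡⟨ coeff-· a p 0 ⟨
    coeff (a · p) 0                      ≡.≡⟨ ℤ.+-identityʳ _ ⟨
    coeff (a · p) 0 + 0ℤ                 ≡.≡⟨ coeff-⊕ (a · p) (0ℤ ∷ p ⊗ x) 0 ⟨
    coeff (a · p ⊕ (0ℤ ∷ p ⊗ x)) 0       ≡.≡⟨ coeff-≡ expanded 0 ⟩
    0ℤ                                   ≡.∎
  shifted : 0ℤ ∷ p ⊗ x ≈ 0ℤ ∷ []
  shifted = begin
    0ℤ ∷ p ⊗ x              ≈⟨ ⊕-cong (0·p≈[] p) (≈-refl {0ℤ ∷ p ⊗ x}) ⟨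
    0ℤ · p ⊕ (0ℤ ∷ p ⊗ x)   ≡⟨ cong (λ b → b · p ⊕ (0ℤ ∷ p ⊗ x)) a≡0 ⟨
    a · p ⊕ (0ℤ ∷ p ⊗ x)    ≈⟨ expanded ⟩
    0#                      ≈⟨ 0∷[]≈[] ⟨
    0ℤ ∷ []                 ∎

nonZeroDivisor-q^ : ∀ k → NonZeroDivisor (q^ k)
nonZeroDivisor-q^ zero    x e = ≈-trans (≈-sym (⊗-identityˡ x)) e
nonZeroDivisor-q^ (suc k) x e = nonZeroDivisor-q^ k x
  (∷-tail {b = 0ℤ} (≈-trans (≈-sym (0∷-⊗ (q^ k) x)) (≈-trans e (≈-sym 0∷[]≈[]))))

nonZeroDivisor-⊗ : ∀ p r → NonZeroDivisor p → NonZeroDivisor r → NonZeroDivisor (p ⊗ r)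
nonZeroDivisor-⊗ p r hp hr x e = hr x (hp (r ⊗ x) (≈-trans (≈-sym (⊗-assoc p r x)) e))

⊗-cancelˡ : ∀ {p} → NonZeroDivisor p → ∀ x y → p ⊗ x ≈ p ⊗ y → x ≈ y
⊗-cancelˡ {p} h x y e = x∙y⁻¹≈ε⇒x≈y x y
  (h (x ⊖ y) (≈-trans (PolyRing.x[y-z]≈xy-xz p x y) (x≈y⇒x∙y⁻¹≈ε e)))

-- Signed continuants and their unimodular rule.

-- The signed continuant: ζ_{k,k+m} is continuant f m for f t = c_{k+t}.
continuant : (ℕ → ℕ) → ℕ → Poly
continuant f zero          = 0#
continuant f (suc zero)    = 1#
continuant f (suc (suc m)) =
  [ f (suc m) ]q ⊗ continuant f (suc m) ⊖ q^ (f m ℕ.∸ 1) ⊗ continuant f m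

continuant-cong : ∀ {f g} → (∀ t → f t ≡ g t) → ∀ m → continuant f m ≡ continuant g m
continuant-cong e zero          = refl
continuant-cong e (suc zero)    = refl
continuant-cong e (suc (suc m)) = cong₂ _⊖_
  (cong₂ _⊗_ (cong [_]q (e (suc m))) (continuant-cong e (suc m)))
  (cong₂ _⊗_ (cong (λ a → q^ (a ℕ.∸ 1)) (e m)) (continuant-cong e m))

-- The recurrence without subtraction, the form that the semiring solver and cancellation of
-- summands can handle.
continuant-rec : ∀ f m → continuant f (2 ℕ.+ m) ⊕ q^ (f m ℕ.∸ 1) ⊗ continuant f m
                       ≈ [ f (suc m) ]q ⊗ continuant f (suc m)
continuant-rec f m = //-rightDividesˡ (q^ (f m ℕ.∸ 1) ⊗ continuant f m) _

continuant-2 : ∀ f → continuant f 2 ≈ [ f 1 ]q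
continuant-2 f = begin
  continuant f 2            ≈⟨ solve 2 (λ x t → x :+ t :* con 0 := x) ≈-refl (continuant f 2) T ⟨
  continuant f 2 ⊕ T ⊗ 0#   ≈⟨ continuant-rec f 0 ⟩
  [ f 1 ]q ⊗ 1#             ≈⟨ solve 1 (λ x → x :* con 1 := x) ≈-refl [ f 1 ]q ⟩
  [ f 1 ]q                  ∎
  where T = q^ (f 0 ℕ.∸ 1)

-- The newest term has coefficient 1, so it is found by cancelling the other summand. `M` relations
-- determine the terms 0 to `M + 1`; the bound matters because labels satisfy the recurrence only
-- along one turn.
continuant-unique : ∀ f (y : ℕ → Poly) M → y 0 ≈ 0# → y 1 ≈ 1# →
  (∀ m → m ℕ.< M → y (2 ℕ.+ m) ⊕ q^ (f m ℕ.∸ 1) ⊗ y m ≈ [ f (suc m) ]q ⊗ y (suc m)) →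
  ∀ m → m ℕ.≤ suc M → y m ≈ continuant f m
continuant-unique f y M y₀ y₁ rec zero          _ = y₀
continuant-unique f y M y₀ y₁ rec (suc zero)    _ = y₁
continuant-unique f y M y₀ y₁ rec (suc (suc m)) (s≤s m<M) =
  ∙-cancelʳ (q^ (f m ℕ.∸ 1) ⊗ continuant f m) _ _ (begin
    y (2 ℕ.+ m) ⊕ q^ (f m ℕ.∸ 1) ⊗ continuant f m                    ≈⟨ ⊕-cong (≈-refl {y (2 ℕ.+ m)}) (⊗-congʳ (q^ (f m ℕ.∸ 1)) (ih m (ℕ.≤-trans (ℕ.<⇒≤ m<M) (ℕ.n≤1+n M)))) ⟨
    y (2 ℕ.+ m) ⊕ q^ (f m ℕ.∸ 1) ⊗ y m                               ≈⟨ rec m m<M ⟩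
    [ f (suc m) ]q ⊗ y (suc m)                                       ≈⟨ ⊗-congʳ [ f (suc m) ]q (ih (suc m) (s≤s (ℕ.<⇒≤ m<M))) ⟩
    [ f (suc m) ]q ⊗ continuant f (suc m)                            ≈⟨ continuant-rec f m ⟨
    continuant f (2 ℕ.+ m) ⊕ q^ (f m ℕ.∸ 1) ⊗ continuant f m         ∎)
  where ih = continuant-unique f y M y₀ y₁ rec

-- A Casoratian: the continuants of `f` and of `f ∘ suc`, the latter delayed by one, solve the same
-- recurrence, so each step multiplies their 2×2 determinant by the coefficient `q^(f (suc m) − 1)`
-- of the oldest term.
continuant-unimodular : ∀ f m →
  continuant f (suc m) ⊗ continuant (f ∘ suc) (suc m)
    ≈ continuant (f ∘ suc) m ⊗ continuant f (2 ℕ.+ m)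
      ⊕ q^ sum (map (λ t → f (suc t) ℕ.∸ 1) (upTo m))
continuant-unimodular f zero    = ≈-refl
continuant-unimodular f (suc m) = ∙-cancelʳ (t ⊗ (C ⊗ B)) _ _ (begin
  B ⊗ Y ⊕ t ⊗ (C ⊗ B)                         ≈⟨ solve 4 (λ B Y t C → B :* Y :+ t :* (C :* B) := B :* (Y :+ t :* C)) ≈-refl B Y t C ⟩
  B ⊗ (Y ⊕ t ⊗ C)                             ≈⟨ ⊗-congʳ B (continuant-rec (f ∘ suc) m) ⟩
  B ⊗ (e ⊗ D)                                 ≈⟨ solve 3 (λ B e D → B :* (e :* D) := D :* (e :* B)) ≈-refl B e D ⟩
  D ⊗ (e ⊗ B)                                 ≈⟨ ⊗-congʳ D (continuant-rec f (suc m)) ⟨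
  D ⊗ (X ⊕ t ⊗ A)                             ≈⟨ solve 4 (λ D X t A → D :* (X :+ t :* A) := D :* X :+ t :* (A :* D)) ≈-refl D X t A ⟩
  D ⊗ X ⊕ t ⊗ (A ⊗ D)                         ≈⟨ ⊕-cong (≈-refl {D ⊗ X}) (⊗-congʳ t (continuant-unimodular f m)) ⟩
  D ⊗ X ⊕ t ⊗ (C ⊗ B ⊕ s)                     ≈⟨ solve 6 (λ D X t C B s → D :* X :+ t :* (C :* B :+ s) := (D :* X :+ s :* t) :+ t :* (C :* B)) ≈-refl D X t C B s ⟩
  (D ⊗ X ⊕ s ⊗ t) ⊕ t ⊗ (C ⊗ B)               ≈⟨ ⊕-cong (⊕-cong (≈-refl {D ⊗ X}) power) (≈-refl {t ⊗ (C ⊗ B)}) ⟩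
  (D ⊗ X ⊕ q^ sum (map g (upTo (suc m)))) ⊕ t ⊗ (C ⊗ B)  ∎)
  where
  g : ℕ → ℕ
  g i = f (suc i) ℕ.∸ 1
  A = continuant f (suc m)
  B = continuant f (2 ℕ.+ m)
  C = continuant (f ∘ suc) m
  D = continuant (f ∘ suc) (suc m)
  X = continuant f (3 ℕ.+ m)
  Y = continuant (f ∘ suc) (2 ℕ.+ m)
  t = q^ (g m)
  e = [ f (2 ℕ.+ m) ]q
  s = q^ sum (map g (upTo m))
  sum-upTo : sum (map g (upTo (suc m))) ≡ sum (map g (upTo m)) ℕ.+ g m
  sum-upTo = ≡.begin
    sum (map g (upTo (suc m)))                   ≡.≡⟨ cong (sum ∘ map g) (upTo-∷ʳ m) ⟨
    sum (map g (upTo m ++ m ∷ []))        ≡.≡⟨ cong sum (map-++ g (upTo m) (m ∷ [])) ⟩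
    sum (map g (upTo m) ++ g m ∷ [])      ≡.≡⟨ sum-++ (map g (upTo m)) (g m ∷ []) ⟩
    sum (map g (upTo m)) ℕ.+ (g m ℕ.+ 0)         ≡.≡⟨ cong (sum (map g (upTo m)) ℕ.+_) (ℕ.+-identityʳ (g m)) ⟩
    sum (map g (upTo m)) ℕ.+ g m                 ≡.∎
  power : s ⊗ t ≈ q^ sum (map g (upTo (suc m)))
  power = ≈-trans (≈-sym (q^-+ (sum (map g (upTo m))) (g m))) (≈-reflexive (cong q^_ (sym sum-upTo)))

-- The frieze consists of the continuants of the quiddity.

⋯-upTo : ∀ a b m → b - a + 1ℤ ≡ + m → [ a ⋯ b ] ≡ map (λ k → a + + k) (upTo m)
⋯-upTo a b m e = cong (λ x → map (λ k → a + + k) (upTo ∣ 0ℤ ⊔ x ∣)) e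

module _ {n : ℕ} .{{_ : NonZero n}} (𝕋 : Triangulation n) where
  open Triangulation 𝕋 using (quiddity)

  quiddityFrom : ℤ → ℕ → ℕ
  quiddityFrom k t = quiddity (k + + t)

  -- Frieze and continuants obey the same unimodular rule, in which every factor but `ζ k ℓ` comes
  -- from the two preceding rows. The divisor in row `m` is a continuant of length `m − 2`; rows 3
  -- to n + 1 thus ask for the lengths 1 to n - 1.
  frieze-continuant : ∀ {ζ} → IsFrieze 𝕋 ζ →
    (∀ k m → m ℕ.< n → 1 ℕ.≤ m → NonZeroDivisor (continuant (quiddityFrom k) m)) →
    ∀ m → m ℕ.≤ suc n → ∀ k → ζ k (k + + m) ≈ continuant (quiddityFrom k) m
  frieze-continuant {ζ} F nz = go
    where
    open IsFrieze F
    shift : ∀ k t → quiddityFrom (k + 1ℤ) t ≡ quiddityFrom k (suc t)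
    shift k t = cong quiddity (ℤ.+-assoc k 1ℤ (+ t))
    Agree : ℕ → Set
    Agree m = ∀ k → ζ k (k + + m) ≈ continuant (quiddityFrom k) m
    step : ∀ m → 3 ℕ.+ m ℕ.≤ suc n → Agree (2 ℕ.+ m) → Agree (suc m) → Agree (3 ℕ.+ m)
    step m le ih₂ ih₁ k = ⊗-cancelˡ {D} (nz (k + 1ℤ) (suc m) (ℕ.≤-pred le) (s≤s z≤n)) _ _
      (∙-cancelʳ (q^ S) _ _ (begin
      D ⊗ ζ k ℓ ⊕ q^ S                                     ≈⟨ ⊕-cong (⊗-cong ζD≈D (≈-refl {ζ k ℓ})) uni ⟨
      ζ (k + 1ℤ) (ℓ - 1ℤ) ⊗ ζ k ℓ ⊕ (P ⊖ ζ (k + 1ℤ) (ℓ - 1ℤ) ⊗ ζ k ℓ) ≈⟨ ⊕-comm (ζ (k + 1ℤ) (ℓ - 1ℤ) ⊗ ζ k ℓ) _ ⟩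
      (P ⊖ ζ (k + 1ℤ) (ℓ - 1ℤ) ⊗ ζ k ℓ) ⊕ ζ (k + 1ℤ) (ℓ - 1ℤ) ⊗ ζ k ℓ ≈⟨ //-rightDividesˡ (ζ (k + 1ℤ) (ℓ - 1ℤ) ⊗ ζ k ℓ) P ⟩
      P                                                    ≈⟨ ⊗-cong ζB≈B ζY≈Y ⟩
      continuant f (2 ℕ.+ m) ⊗ continuant (f ∘ suc) (2 ℕ.+ m)   ≈⟨ continuant-unimodular f (suc m) ⟩
      continuant (f ∘ suc) (suc m) ⊗ continuant f (3 ℕ.+ m) ⊕ q^ S′
        ≡⟨ cong₂ (λ d x → d ⊗ continuant f (3 ℕ.+ m) ⊕ q^ x) (continuant-cong (shift k) (suc m)) S≡S′ ⟨
      D ⊗ continuant f (3 ℕ.+ m) ⊕ q^ S                    ∎))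
      where
      f = quiddityFrom k
      ℓ = k + + (3 ℕ.+ m)
      D = continuant (quiddityFrom (k + 1ℤ)) (suc m)
      P = ζ k (ℓ - 1ℤ) ⊗ ζ (k + 1ℤ) ℓ
      S = sum (map (λ u → quiddity u ℕ.∸ 1) [ k + 1ℤ ⋯ ℓ - + 2 ])
      S′ = sum (map (λ t → f (suc t) ℕ.∸ 1) (upTo (suc m)))
      uni = unimodular k ℓ (ℤ.+-monoʳ-≤ k (ℤ.+≤+ (s≤s (s≤s (s≤s z≤n)))))
        (ℤ.≤-trans (ℤ.+-monoʳ-≤ k (ℤ.+≤+ le))
          (ℤ.≤-reflexive (trans (cong (λ x → k + + x) (ℕ.+-comm 1 n)) (sym (ℤ.+-assoc k (+ n) 1ℤ)))))
      pred-ℓ : ℓ - 1ℤ ≡ k + + (2 ℕ.+ m)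
      pred-ℓ = lemma k (+ m)
        where
        lemma : ∀ k x → k + (+ 3 + x) - 1ℤ ≡ k + (+ 2 + x)
        lemma = ℤSolver.solve-∀
      pred-ℓ′ : ℓ - 1ℤ ≡ k + 1ℤ + + (1 ℕ.+ m)
      pred-ℓ′ = lemma k (+ m)
        where
        lemma : ∀ k x → k + (+ 3 + x) - 1ℤ ≡ k + 1ℤ + (+ 1 + x)
        lemma = ℤSolver.solve-∀
      ℓ≡ : ℓ ≡ k + 1ℤ + + (2 ℕ.+ m)
      ℓ≡ = sym (ℤ.+-assoc k 1ℤ (+ (2 ℕ.+ m)))
      ζB≈B : ζ k (ℓ - 1ℤ) ≈ continuant f (2 ℕ.+ m)
      ζB≈B = ≈-trans (≈-reflexive (cong (ζ k) pred-ℓ)) (ih₂ k)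
      ζY≈Y : ζ (k + 1ℤ) ℓ ≈ continuant (f ∘ suc) (2 ℕ.+ m)
      ζY≈Y = ≈-trans (≈-reflexive (cong (ζ (k + 1ℤ)) ℓ≡))
        (≈-trans (ih₂ (k + 1ℤ)) (≈-reflexive (continuant-cong (shift k) (2 ℕ.+ m))))
      ζD≈D : ζ (k + 1ℤ) (ℓ - 1ℤ) ≈ D
      ζD≈D = ≈-trans (≈-reflexive (cong (ζ (k + 1ℤ)) pred-ℓ′))
        (ih₁ (k + 1ℤ))
      S≡S′ : S ≡ S′
      S≡S′ = ≡.begin
        S  ≡.≡⟨ cong (sum ∘ map (λ u → quiddity u ℕ.∸ 1)) (⋯-upTo (k + 1ℤ) (ℓ - + 2) (suc m) (lemma k (+ m))) ⟩
        sum (map (λ u → quiddity u ℕ.∸ 1) (map (λ t → k + 1ℤ + + t) (upTo (suc m)))) ≡.≡⟨ cong sum (map-∘ (upTo (suc m))) ⟨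
        sum (map (λ t → quiddity (k + 1ℤ + + t) ℕ.∸ 1) (upTo (suc m))) ≡.≡⟨ cong sum (map-cong (λ t → cong (ℕ._∸ 1) (shift k t)) (upTo (suc m))) ⟩
        S′ ≡.∎
        where
        lemma : ∀ k x → k + (+ 3 + x) - + 2 - (k + 1ℤ) + 1ℤ ≡ + 1 + x
        lemma = ℤSolver.solve-∀
    go : ∀ m → m ℕ.≤ suc n → Agree m
    go zero          _ k = ≈-trans (≈-reflexive (cong (ζ k) (ℤ.+-identityʳ k))) (row₀ k)
    go (suc zero)    _ k = row₁ k
    go (suc (suc zero)) _ k = ≈-trans (row₂ k) (≈-sym (continuant-2 (quiddityFrom k)))
    go (suc (suc (suc m))) le = step m le
      (go (suc (suc m)) (ℕ.≤-trans (ℕ.n≤1+n _) le))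
      (go (suc m) (ℕ.≤-trans (ℕ.n≤1+n _) (ℕ.≤-trans (ℕ.n≤1+n _) le)))

-- Counting over intervals.

indicator : ∀ {A : Set} → Dec A → ℕ
indicator (yes _) = 1
indicator (no  _) = 0

-- Quiddity, degrees and descendant degrees are all brought to this form: an interval given by start
-- and length can be cut at any vertex.
tally : ∀ {P : ℕ → Set} → Decidable P → ℕ → ℕ → ℕ
tally P? a zero    = 0
tally P? a (suc m) = indicator (P? a) ℕ.+ tally P? (suc a) m

module _ {P : ℕ → Set} (P? : Decidable P) where

  tally-+ : ∀ a m m′ → tally P? a (m ℕ.+ m′) ≡ tally P? a m ℕ.+ tally P? (a ℕ.+ m) m′
  tally-+ a zero    m′ = cong (λ x → tally P? x m′) (sym (ℕ.+-identityʳ a))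
  tally-+ a (suc m) m′ rewrite ℕ.+-suc a m = trans
    (cong (indicator (P? a) ℕ.+_) (tally-+ (suc a) m m′))
    (sym (ℕ.+-assoc (indicator (P? a)) (tally P? (suc a) m) _))

  tally-none : ∀ a m → (∀ k → a ℕ.≤ k → k ℕ.< a ℕ.+ m → ¬ P k) → tally P? a m ≡ 0
  tally-none a zero    none = refl
  tally-none a (suc m) none with P? a
  ... | yes Pa = ⊥-elim (none a ℕ.≤-refl (ℕ.m<m+n a (s≤s z≤n)) Pa)
  ... | no  _  = tally-none (suc a) m λ k a<k k< → none k (ℕ.<⇒≤ a<k) (subst (k ℕ.<_) (sym (ℕ.+-suc a m)) k<)

  tally-first : ∀ a m → P a → tally P? a (suc m) ≡ suc (tally P? (suc a) m)
  tally-first a m Pa with P? a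
  ... | yes _  = refl
  ... | no ¬Pa = ⊥-elim (¬Pa Pa)

  tally-last : ∀ a m → P (a ℕ.+ m) → tally P? a (suc m) ≡ suc (tally P? a m)
  tally-last a m P[a+m] = ≡.begin
    tally P? a (suc m)                         ≡.≡⟨ cong (tally P? a) (ℕ.+-comm 1 m) ⟩
    tally P? a (m ℕ.+ 1)                       ≡.≡⟨ tally-+ a m 1 ⟩
    tally P? a m ℕ.+ tally P? (a ℕ.+ m) 1      ≡.≡⟨ cong (tally P? a m ℕ.+_) (tally-first (a ℕ.+ m) 0 P[a+m]) ⟩
    tally P? a m ℕ.+ 1                         ≡.≡⟨ ℕ.+-comm _ 1 ⟩
    suc (tally P? a m)                         ≡.∎

indicator-cong : ∀ {A B : Set} (a? : Dec A) (b? : Dec B) → (A → B) → (B → A) → indicator a? ≡ indicator b?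
indicator-cong (yes _) (yes _) _ _ = refl
indicator-cong (yes a) (no ¬b) f _ = ⊥-elim (¬b (f a))
indicator-cong (no ¬a) (yes b) _ g = ⊥-elim (¬a (g b))
indicator-cong (no _)  (no _)  _ _ = refl

-- Terms are matched by their offset, since a change of base vertex or a full turn moves the start
-- of the interval.
tally-cong : ∀ {P Q : ℕ → Set} (P? : Decidable P) (Q? : Decidable Q) a b m →
  (∀ k → k ℕ.< m → (P (a ℕ.+ k) → Q (b ℕ.+ k)) × (Q (b ℕ.+ k) → P (a ℕ.+ k))) →
  tally P? a m ≡ tally Q? b m
tally-cong P? Q? a b zero    h = refl
tally-cong {P} {Q} P? Q? a b (suc m) h = cong₂ ℕ._+_
  (indicator-cong (P? a) (Q? b)
    (λ x → subst Q (ℕ.+-identityʳ b) (proj₁ (h 0 (s≤s z≤n)) (subst P (sym (ℕ.+-identityʳ a)) x)))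
    (λ x → subst P (ℕ.+-identityʳ a) (proj₂ (h 0 (s≤s z≤n)) (subst Q (sym (ℕ.+-identityʳ b)) x))))
  (tally-cong P? Q? (suc a) (suc b) m λ k k<m →
    let f , g = h (suc k) (s≤s k<m) in
    (λ x → subst Q (ℕ.+-suc b k) (f (subst P (sym (ℕ.+-suc a k)) x))) ,
    (λ x → subst P (ℕ.+-suc a k) (g (subst Q (sym (ℕ.+-suc b k)) x))))

length-filter-applyUpTo : ∀ {A : Set} {P : A → Set} (P? : Decidable P) (f : ℕ → A) m →
  length (filter P? (applyUpTo f m)) ≡ tally (P? ∘ f) 0 m
length-filter-applyUpTo P? f zero    = refl
length-filter-applyUpTo P? f (suc m) with P? (f 0)
... | yes _ = cong suc (trans (length-filter-applyUpTo P? (f ∘ suc) m)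
                (tally-cong (P? ∘ f ∘ suc) (P? ∘ f) 0 1 m λ _ _ → (λ x → x) , (λ x → x)))
... | no  _ = trans (length-filter-applyUpTo P? (f ∘ suc) m)
                (tally-cong (P? ∘ f ∘ suc) (P? ∘ f) 0 1 m λ _ _ → (λ x → x) , (λ x → x))

-- Splicing, and the label rule of a single cell.

glue : ∀ {A : Set} (g p : ℕ) → A → A → A
glue g p x y with p ℕ.≤? g
... | yes _ = x
... | no  _ = y

glue-≤ : ∀ {A : Set} {g p} {x y : A} → p ℕ.≤ g → glue g p x y ≡ x
glue-≤ {g = g} {p} p≤g with p ℕ.≤? g
... | yes _  = refl
... | no p≰g = ⊥-elim (p≰g p≤g)

glue-> : ∀ {A : Set} {g p} {x y : A} → g ℕ.< p → glue g p x y ≡ y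
glue-> {g = g} {p} g<p with p ℕ.≤? g
... | yes p≤g = ⊥-elim (ℕ.<⇒≱ g<p p≤g)
... | no  _   = refl

-- The labelling rule for a cell `b < g < a`. Exponents are raised by one, `x` standing for the
-- weight `q^(x − 1)`, so that the base edge has the natural number 0.
CellRule : (rg ra rb : Poly) (wba wga wbg : ℕ) → Set
CellRule rg ra rb wba wga wbg = rg ≈ ra ⊕ q^ wba ⊗ rb × wga ≡ 1 × wbg ≡ suc wba

cellRule-resp : ∀ {rg rg′ ra ra′ rb rb′ wba wba′ wga wga′ wbg wbg′} →
  rg ≡ rg′ → ra ≡ ra′ → rb ≡ rb′ → wba ≡ wba′ → wga ≡ wga′ → wbg ≡ wbg′ →
  CellRule rg′ ra′ rb′ wba′ wga′ wbg′ → CellRule rg ra rb wba wga wbg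
cellRule-resp refl refl refl refl refl refl h = h

coeff₀-q^suc : ∀ k p → coeff (q^ suc k ⊗ p) 0 ≡ 0ℤ
coeff₀-q^suc k p = _≈_.coeff-≡ (0∷-⊗ (q^ k) p) 0

-- Labellings of a triangulated polygon.

-- Triangulated polygon with vertices 0, …, N and base edge {0, N}; J p q says
-- that p and q are joined.
module Window (N : ℕ) (2≤N : 2 ℕ.≤ N) (J : ℕ → ℕ → Set) (J? : ∀ p q → Dec (J p q))
  (J-side : ∀ p → p ℕ.< N → J p (suc p))
  (J-base : J 0 N)
  (noncrossing : ∀ {a b c d} → a ℕ.< b → b ℕ.< c → c ℕ.< d → d ℕ.≤ N → J a c → ¬ J b d)
  (apex : ∀ {b a} → 2 ℕ.+ b ℕ.≤ a → a ℕ.≤ N → J b a → ∃ λ g → b ℕ.< g × g ℕ.< a × J b g × J g a)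
  where

  leftCount rightCount : ℕ → ℕ → ℕ → ℕ
  leftCount  j = tally λ p → J? p j
  rightCount j = tally (J? j)

  -- Polygon sides to the adjacent positions are left out, but the base edge is counted: in
  -- `rightDegree 0` and in `leftDegree N`.
  leftDegree rightDegree : ℕ → ℕ
  leftDegree  j = leftCount j 0 (j ℕ.∸ 1)
  rightDegree j = rightCount j (2 ℕ.+ j) (N ℕ.∸ suc j)

  -- Weight b a x says that the segment from b to a has weight q^(x − 1).
  record Labelling (Weight : ℕ → ℕ → ℕ → Set) (r : ℕ → Poly) : Set where
    field
      base : Weight 0 N 0
      cell : ∀ {b g a x} → b ℕ.< g → g ℕ.< a → a ℕ.≤ N → J b g → J g a → J b a → Weight b a x →
        r g ≈ r a ⊕ q^ x ⊗ r b × Weight g a 1 × Weight b g (suc x)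

  -- Fans of cells around a vertex.

  module _ {Weight : ℕ → ℕ → ℕ → Set} {r : ℕ → Poly} (L : Labelling Weight r) where
    open Labelling L

    -- Passing from `{j, a}` to the side `{j, g}` of the cell beyond it adds `q^y ⊗ r j` and raises
    -- `y` by one, so the multiples of `r j` sum to `q^y [ν]`. Each cell passed is counted by its
    -- vertex `a`; hence `ν` includes the starting `a` but not `j + 1`.
    right-fan : ∀ d → Acc ℕ._<_ d → ∀ j a y → suc j ℕ.+ d ≡ a → a ℕ.≤ N → J j a → Weight j a y →
      let ν = rightCount j (2 ℕ.+ j) d in
      Weight j (suc j) (y ℕ.+ ν) × r (suc j) ≈ r a ⊕ q^ y ⊗ [ ν ]q ⊗ r j
    right-fan zero _ j a y eq a≤N _ W
      rewrite ℕ.+-identityʳ (suc j) | ℕ.+-identityʳ y | sym eq =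
      W , solve 3 (λ a y j → a := a :+ y :* con 0 :* j) ≈-refl (r (suc j)) (q^ y) (r j)
    right-fan (suc d) (acc rs) j a y eq a≤N Ja W
      with g , j<g , g<a , Jjg , Jga ← apex (subst (2 ℕ.+ j ℕ.≤_) eq (ℕ.≤-trans (ℕ.m≤m+n (2 ℕ.+ j) d) (ℕ.≤-reflexive (cong suc (sym (ℕ.+-suc j d)))))) a≤N Ja
      -- Offsets from the apex: `g = j + 1 + x` and `a = g + 1 + e`, whence `d = x + e`.
      with x , refl ← ℕ.m≤n⇒∃[o]m+o≡n j<g
      with e , refl ← ℕ.m≤n⇒∃[o]m+o≡n g<a
      with r-g , _ , W′ ← cell j<g g<a a≤N Jjg Jga Ja W
      with refl ← ℕ.+-cancelˡ-≡ (suc j) d (x ℕ.+ e) (ℕ.suc-injective (trans (sym (ℕ.+-suc (suc j) d)) (trans eq (cong suc (ℕ.+-assoc (suc j) x e)))))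
      with W″ , r-j ← right-fan x (rs (s≤s (ℕ.m≤m+n x e))) j (suc j ℕ.+ x) (suc y) refl (ℕ.≤-trans (ℕ.<⇒≤ g<a) a≤N) Jjg W′
      = subst (Weight j (suc j)) (trans (sym (ℕ.+-suc y ν′)) (cong (y ℕ.+_) (sym ν≡))) W″ , (begin
        r (suc j)                                                     ≈⟨ r-j ⟩
        r (suc j ℕ.+ x) ⊕ q^ suc y ⊗ [ ν′ ]q ⊗ r j                    ≈⟨ ⊕-cong r-g (⊗-cong (⊗-cong (q^-+ 1 y) (≈-refl {[ ν′ ]q})) (≈-refl {r j})) ⟩
        (r a ⊕ q^ y ⊗ r j) ⊕ (q^ 1 ⊗ q^ y) ⊗ [ ν′ ]q ⊗ r j            ≈⟨ solve 5 (λ a y j q ν → (a :+ y :* j) :+ (q :* y) :* ν :* j := a :+ y :* (con 1 :+ q :* ν) :* j) ≈-refl (r a) (q^ y) (r j) (q^ 1) [ ν′ ]q ⟩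
        r a ⊕ q^ y ⊗ (1# ⊕ q^ 1 ⊗ [ ν′ ]q) ⊗ r j                      ≈⟨ ⊕-cong (≈-refl {r a}) (⊗-cong (⊗-congʳ (q^ y) ([]q-+ 1 ν′)) (≈-refl {r j})) ⟨
        r a ⊕ q^ y ⊗ [ suc ν′ ]q ⊗ r j                                ≡⟨ cong (λ k → r a ⊕ q^ y ⊗ [ k ]q ⊗ r j) ν≡ ⟨
        r a ⊕ q^ y ⊗ [ rightCount j (2 ℕ.+ j) (suc d) ]q ⊗ r j        ∎)
      where
      ν′ = rightCount j (2 ℕ.+ j) x
      ν≡ : rightCount j (2 ℕ.+ j) (suc (x ℕ.+ e)) ≡ suc ν′
      ν≡ = ≡.begin
        rightCount j (2 ℕ.+ j) (suc (x ℕ.+ e))  ≡.≡⟨ tally-last (J? j) (2 ℕ.+ j) (x ℕ.+ e) (subst (J j) (cong suc (ℕ.+-assoc (suc j) x e)) Ja) ⟩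
        suc (rightCount j (2 ℕ.+ j) (x ℕ.+ e))  ≡.≡⟨ cong suc (tally-+ (J? j) (2 ℕ.+ j) x e) ⟩
        -- A neighbour of `j` strictly between `g` and `a` would be joined across `{g, a}`.
        suc (ν′ ℕ.+ rightCount j (2 ℕ.+ j ℕ.+ x) e) ≡.≡⟨ cong (λ k → suc (ν′ ℕ.+ k)) (tally-none (J? j) (2 ℕ.+ j ℕ.+ x) e λ k g<k k<a Jjk → noncrossing j<g g<k k<a a≤N Jjk Jga) ⟩
        suc (ν′ ℕ.+ 0)                          ≡.≡⟨ cong suc (ℕ.+-identityʳ ν′) ⟩
        suc ν′                                  ≡.∎

    -- Now the larger endpoint `k + 1` is fixed. The side `{g, k + 1}` of the next cell has weight 1
    -- whatever `y` was, so the walk restarts there, and `y` comes back only when `r g` is expanded.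
    -- If there is no cell to pass, the side is `{b, k + 1}` itself and `e = y`.
    left-fan : ∀ d → Acc ℕ._<_ d → ∀ b k y → b ℕ.+ d ≡ k → suc k ℕ.≤ N → J b (suc k) → Weight b (suc k) (suc y) →
      let μ = leftCount (suc k) b d in
      ∃ λ e → Weight k (suc k) (suc e) × q^ e ⊗ r k ≈ [ μ ]q ⊗ r (suc k) ⊕ q^ (y ℕ.+ μ) ⊗ r b
    left-fan zero _ b k y eq _ _ W rewrite ℕ.+-identityʳ b | ℕ.+-identityʳ y | eq = y , W , ≈-refl
    left-fan (suc d) (acc rs) b k y eq k<N Jb W
      with g , b<g , g<a , Jbg , Jga ← apex (s≤s (subst (suc b ℕ.≤_) (trans (sym (ℕ.+-suc b d)) eq) (s≤s (ℕ.m≤m+n b d)))) k<N Jb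
      with x , refl ← ℕ.m≤n⇒∃[o]m+o≡n b<g
      with f , refl ← ℕ.m≤n⇒∃[o]m+o≡n (ℕ.≤-pred g<a)
      with r-g , W′ , _ ← cell b<g g<a k<N Jbg Jga Jb W
      with refl ← ℕ.+-cancelˡ-≡ (suc b) d (x ℕ.+ f) (trans (sym (ℕ.+-suc b d)) (trans eq (ℕ.+-assoc (suc b) x f)))
      with e , W″ , r-k ← left-fan f (rs (s≤s (ℕ.m≤n+m f x))) (suc b ℕ.+ x) k 0 refl k<N Jga W′
      = e , W″ , (begin
        q^ e ⊗ r k                                             ≈⟨ r-k ⟩
        [ μ′ ]q ⊗ r (suc k) ⊕ q^ μ′ ⊗ r (suc b ℕ.+ x)          ≈⟨ ⊕-cong (≈-refl {[ μ′ ]q ⊗ r (suc k)}) (⊗-congʳ (q^ μ′) r-g) ⟩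
        [ μ′ ]q ⊗ r (suc k) ⊕ q^ μ′ ⊗ (r (suc k) ⊕ q^ suc y ⊗ r b) ≈⟨ solve 5 (λ m z s y b → m :* z :+ s :* (z :+ y :* b) := (m :+ s :* con 1) :* z :+ (y :* s) :* b) ≈-refl [ μ′ ]q (r (suc k)) (q^ μ′) (q^ suc y) (r b) ⟩
        ([ μ′ ]q ⊕ q^ μ′ ⊗ [ 1 ]q) ⊗ r (suc k) ⊕ (q^ suc y ⊗ q^ μ′) ⊗ r b ≈⟨ ⊕-cong (⊗-cong ([]q-+ μ′ 1) (≈-refl {r (suc k)})) (⊗-cong (q^-+ (suc y) μ′) (≈-refl {r b})) ⟨
        [ μ′ ℕ.+ 1 ]q ⊗ r (suc k) ⊕ q^ (suc y ℕ.+ μ′) ⊗ r b ≡⟨ cong₂ (λ m m′ → [ m ]q ⊗ r (suc k) ⊕ q^ m′ ⊗ r b) (trans μ≡ (ℕ.+-comm 1 μ′)) (trans (cong (y ℕ.+_) μ≡) (ℕ.+-suc y μ′)) ⟨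
        [ leftCount (suc k) b (suc d) ]q ⊗ r (suc k) ⊕ q^ (y ℕ.+ leftCount (suc k) b (suc d)) ⊗ r b ∎)
      where
      μ′ = leftCount (suc k) (suc b ℕ.+ x) f
      μ≡ : leftCount (suc k) b (suc (x ℕ.+ f)) ≡ suc μ′
      μ≡ = ≡.begin
        leftCount (suc k) b (suc (x ℕ.+ f))       ≡.≡⟨ tally-first (λ p → J? p (suc k)) b (x ℕ.+ f) Jb ⟩
        suc (leftCount (suc k) (suc b) (x ℕ.+ f)) ≡.≡⟨ cong suc (tally-+ (λ p → J? p (suc k)) (suc b) x f) ⟩
        suc (leftCount (suc k) (suc b) x ℕ.+ μ′)  ≡.≡⟨ cong (λ m → suc (m ℕ.+ μ′)) (tally-none (λ p → J? p (suc k)) (suc b) x λ p b<p p<g Jp → noncrossing b<p p<g g<a k<N Jbg Jp) ⟩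
        suc μ′                                    ≡.∎

    -- The cell having `j` as its third vertex, off its base side: the cell at `v_j` with fewest
    -- ancestors. It separates the two fans at `j`.
    record Apical (j : ℕ) : Set where
      field
        {b a x} : ℕ
        b<j : b ℕ.< j
        j<a : j ℕ.< a
        a≤N : a ℕ.≤ N
        Jbj : J b j
        Jja : J j a
        Jba : J b a
        weight : Weight b a x

    -- Descent from the base edge: if the apex of the cell beyond `{b, a}` is not `j`, then `j` lies
    -- strictly inside one of the other two sides, which is shorter.
    apical-below : ∀ {j} d → Acc ℕ._<_ d → ∀ {b a x} → b ℕ.+ d ≡ a → b ℕ.< j → j ℕ.< a → a ℕ.≤ N →
      J b a → Weight b a x → Apical j
    apical-below {j} d (acc rs) {b} {a} refl b<j j<a a≤N Jba W
      with g , b<g , g<a , Jbg , Jga ← apex (ℕ.≤-trans (s≤s b<j) j<a) a≤N Jba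
      with _ , W₁ , W₂ ← cell b<g g<a a≤N Jbg Jga Jba W
      with x , eqx ← ℕ.m≤n⇒∃[o]m+o≡n (ℕ.<⇒≤ b<g)
      with y , eqy ← ℕ.m≤n⇒∃[o]m+o≡n (ℕ.<⇒≤ g<a)
      with ℕ.<-cmp j g
    ... | tri≈ _ refl _ = record { b<j = b<g ; j<a = g<a ; a≤N = a≤N ; Jbj = Jbg ; Jja = Jga ; Jba = Jba ; weight = W }
    ... | tri< j<g _ _ = apical-below x (rs (ℕ.+-cancelˡ-< b x d (subst (ℕ._< a) (sym eqx) g<a))) eqx b<j j<g (ℕ.≤-trans (ℕ.<⇒≤ g<a) a≤N) Jbg W₂
    ... | tri> _ _ g<j = apical-below y (rs (ℕ.+-cancelˡ-< g y d (subst (ℕ._< g ℕ.+ d) (sym eqy) (ℕ.+-monoˡ-< d b<g)))) eqy g<j j<a a≤N Jga W₁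

    apical : ∀ j → 0 ℕ.< j → j ℕ.< N → Apical j
    apical j 0<j j<N = apical-below N (<-wellFounded N) refl 0<j j<N ℕ.≤-refl J-base base

    -- The side `{j, a}` of the apical cell has weight 1, hence `y = 1`. A neighbour beyond `a`
    -- would cross `{b, a}`, so the fan exhausts the right degree.
    right-of-apical : ∀ {j} → 0 ℕ.< j → j ℕ.< N → (A : Apical j) → let open Apical A in
      Weight j (suc j) (suc (rightDegree j)) × r (suc j) ≈ r a ⊕ q^ 1 ⊗ [ rightDegree j ]q ⊗ r j
    right-of-apical {j} 0<j j<N A with d , eqd ← ℕ.m≤n⇒∃[o]m+o≡n (Apical.j<a A) | z , eqz ← ℕ.m≤n⇒∃[o]m+o≡n (Apical.a≤N A)
      = subst (λ ν → Weight j (suc j) (suc ν) × r (suc j) ≈ r a ⊕ q^ 1 ⊗ [ ν ]q ⊗ r j) (sym ν≡)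
          (right-fan d (<-wellFounded d) j a 1 eqd a≤N Jja (proj₁ (proj₂ (cell b<j j<a a≤N Jbj Jja Jba weight))))
      where
      open Apical A
      ν≡ : rightDegree j ≡ rightCount j (2 ℕ.+ j) d
      ν≡ = ≡.begin
        rightCount j (2 ℕ.+ j) (N ℕ.∸ suc j)
          ≡.≡⟨ cong (λ n → rightCount j (2 ℕ.+ j) (n ℕ.∸ suc j)) (trans (sym eqz) (trans (cong (ℕ._+ z) (sym eqd)) (ℕ.+-assoc (suc j) d z))) ⟩
        rightCount j (2 ℕ.+ j) (suc j ℕ.+ (d ℕ.+ z) ℕ.∸ suc j)
          ≡.≡⟨ cong (rightCount j (2 ℕ.+ j)) (ℕ.m+n∸m≡n (suc j) (d ℕ.+ z)) ⟩
        rightCount j (2 ℕ.+ j) (d ℕ.+ z)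
          ≡.≡⟨ tally-+ (J? j) (2 ℕ.+ j) d z ⟩
        rightCount j (2 ℕ.+ j) d ℕ.+ rightCount j (suc (suc j ℕ.+ d)) z
          ≡.≡⟨ cong (rightCount j (2 ℕ.+ j) d ℕ.+_) (tally-none (J? j) (suc (suc j ℕ.+ d)) z λ k a<k k≤N Jjk →
                 noncrossing b<j j<a (subst (ℕ._< k) eqd a<k)
                   (ℕ.≤-pred (subst (k ℕ.<_) (cong suc (trans (cong (ℕ._+ z) eqd) eqz)) k≤N)) Jba Jjk) ⟩
        rightCount j (2 ℕ.+ j) d ℕ.+ 0
          ≡.≡⟨ ℕ.+-identityʳ _ ⟩
        rightCount j (2 ℕ.+ j) d ≡.∎

    -- The side `{b, j}` of the apical cell has weight `q^x`; neighbours before `b` are excluded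
    -- because they would cross `{b, a}`.
    left-of-apical : ∀ {k} → suc k ℕ.< N → (A : Apical (suc k)) → let open Apical A in
      ∃ λ e → Weight k (suc k) (suc e) ×
        q^ e ⊗ r k ≈ [ leftDegree (suc k) ]q ⊗ r (suc k) ⊕ q^ (x ℕ.+ leftDegree (suc k)) ⊗ r b
    left-of-apical {k} k<N A with d , eqd ← ℕ.m≤n⇒∃[o]m+o≡n (ℕ.≤-pred (Apical.b<j A))
      = subst (λ μ → ∃ λ e → Weight k (suc k) (suc e) × q^ e ⊗ r k ≈ [ μ ]q ⊗ r (suc k) ⊕ q^ (x ℕ.+ μ) ⊗ r b) (sym μ≡)
          (left-fan d (<-wellFounded d) b k x eqd (ℕ.<⇒≤ k<N) Jbj (proj₂ (proj₂ (cell b<j j<a a≤N Jbj Jja Jba weight))))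
      where
      open Apical A
      μ≡ : leftDegree (suc k) ≡ leftCount (suc k) b d
      μ≡ = ≡.begin
        leftCount (suc k) 0 k                          ≡.≡⟨ cong (leftCount (suc k) 0) eqd ⟨
        leftCount (suc k) 0 (b ℕ.+ d)                  ≡.≡⟨ tally-+ (λ p → J? p (suc k)) 0 b d ⟩
        leftCount (suc k) 0 b ℕ.+ leftCount (suc k) b d
          ≡.≡⟨ cong (ℕ._+ leftCount (suc k) b d) (tally-none (λ p → J? p (suc k)) 0 b λ p _ p<b Jp →
                 noncrossing p<b b<j j<a a≤N Jp Jba) ⟩
        leftCount (suc k) b d ≡.∎

    -- The terms in `r a` and `r b` left over by the two fans combine to `q^μ (r a + q^x r b)`,
    -- which the apical cell turns into `q^μ r j`. What remains is
    -- `[μ] + q^μ (1 + q [ν]) = [μ + 1 + ν]`.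
    inner-relation : ∀ k → suc k ℕ.< N → ∃ λ e → Weight k (suc k) (suc e) ×
      q^ leftDegree (suc k) ⊗ r (2 ℕ.+ k) ⊕ q^ e ⊗ r k
        ≈ [ leftDegree (suc k) ℕ.+ suc (rightDegree (suc k)) ]q ⊗ r (suc k)
    inner-relation k k<N
      with A ← apical (suc k) (s≤s z≤n) k<N
      with e , W , r-k ← left-of-apical k<N A
      = e , W , (begin
        q^ μ ⊗ r (2 ℕ.+ k) ⊕ q^ e ⊗ r k
          ≈⟨ ⊕-cong (⊗-congʳ (q^ μ) (proj₂ (right-of-apical (s≤s z≤n) k<N A))) r-k ⟩
        q^ μ ⊗ (r a ⊕ q^ 1 ⊗ [ ν ]q ⊗ r j) ⊕ ([ μ ]q ⊗ r j ⊕ q^ (x ℕ.+ μ) ⊗ r b)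
          ≈⟨ ⊕-cong (≈-refl {q^ μ ⊗ (r a ⊕ q^ 1 ⊗ [ ν ]q ⊗ r j)}) (⊕-cong (≈-refl {[ μ ]q ⊗ r j}) (⊗-cong (q^-+ x μ) (≈-refl {r b}))) ⟩
        q^ μ ⊗ (r a ⊕ q^ 1 ⊗ [ ν ]q ⊗ r j) ⊕ ([ μ ]q ⊗ r j ⊕ q^ x ⊗ q^ μ ⊗ r b)
          ≈⟨ solve 8 (λ s a q n j m x b → s :* (a :+ q :* n :* j) :+ (m :* j :+ x :* s :* b) := m :* j :+ s :* ((a :+ x :* b) :+ q :* n :* j)) ≈-refl (q^ μ) (r a) (q^ 1) [ ν ]q (r j) [ μ ]q (q^ x) (r b) ⟩
        [ μ ]q ⊗ r j ⊕ q^ μ ⊗ ((r a ⊕ q^ x ⊗ r b) ⊕ q^ 1 ⊗ [ ν ]q ⊗ r j)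
          ≈⟨ ⊕-cong (≈-refl {[ μ ]q ⊗ r j}) (⊗-congʳ (q^ μ) (⊕-cong (proj₁ (cell b<j j<a a≤N Jbj Jja Jba weight)) (≈-refl {q^ 1 ⊗ [ ν ]q ⊗ r j}))) ⟨
        [ μ ]q ⊗ r j ⊕ q^ μ ⊗ (r j ⊕ q^ 1 ⊗ [ ν ]q ⊗ r j)
          ≈⟨ solve 5 (λ m j s q n → m :* j :+ s :* (j :+ q :* n :* j) := (m :+ s :* (con 1 :+ q :* n)) :* j) ≈-refl [ μ ]q (r j) (q^ μ) (q^ 1) [ ν ]q ⟩
        ([ μ ]q ⊕ q^ μ ⊗ ([ 1 ]q ⊕ q^ 1 ⊗ [ ν ]q)) ⊗ r j
          ≈⟨ ⊗-cong (⊕-cong (≈-refl {[ μ ]q}) (⊗-congʳ (q^ μ) ([]q-+ 1 ν))) (≈-refl {r j}) ⟨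
        ([ μ ]q ⊕ q^ μ ⊗ [ suc ν ]q) ⊗ r j
          ≈⟨ ⊗-cong ([]q-+ μ (suc ν)) (≈-refl {r j}) ⟨
        [ μ ℕ.+ suc ν ]q ⊗ r j ∎)
      where
      open Apical A
      j = suc k
      μ = leftDegree (suc k)
      ν = rightDegree (suc k)

    -- An endpoint of the base edge has no apical cell. The first cell is unfolded separately,
    -- because the base weight `q^(−1)` is not of the form `q^y` that `left-fan` starts from; this
    -- accounts for the exponent one below the degree.
    last-relation : ∀ k → suc k ≡ N → ∃ λ e → Weight k (suc k) (suc e) ×
      q^ e ⊗ r k ≈ [ leftDegree (suc k) ]q ⊗ r (suc k) ⊕ q^ (leftDegree (suc k) ℕ.∸ 1) ⊗ r 0
    last-relation k eq
      with g , 0<g , g<N , J0g , JgN ← apex 2≤N ℕ.≤-refl J-base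
      with r-g , W , _ ← cell 0<g g<N ℕ.≤-refl J0g JgN J-base base
      with refl ← eq
      with x , refl ← ℕ.m≤n⇒∃[o]m+o≡n 0<g
      with f , refl ← ℕ.m≤n⇒∃[o]m+o≡n (ℕ.≤-pred g<N)
      with e , W′ , r-k ← left-fan f (<-wellFounded f) (suc x) (suc x ℕ.+ f) 0 refl ℕ.≤-refl JgN W
      = e , W′ , (begin
        q^ e ⊗ r k                                             ≈⟨ r-k ⟩
        [ μ′ ]q ⊗ r N ⊕ q^ μ′ ⊗ r (suc x)                      ≈⟨ ⊕-cong (≈-refl {[ μ′ ]q ⊗ r N}) (⊗-congʳ (q^ μ′) r-g) ⟩
        [ μ′ ]q ⊗ r N ⊕ q^ μ′ ⊗ (r N ⊕ 1# ⊗ r 0)               ≈⟨ solve 4 (λ m n s o → m :* n :+ s :* (n :+ con 1 :* o) := (m :+ s :* con 1) :* n :+ s :* o) ≈-refl [ μ′ ]q (r N) (q^ μ′) (r 0) ⟩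
        ([ μ′ ]q ⊕ q^ μ′ ⊗ [ 1 ]q) ⊗ r N ⊕ q^ μ′ ⊗ r 0         ≈⟨ ⊕-cong (⊗-cong ([]q-+ μ′ 1) (≈-refl {r N})) (≈-refl {q^ μ′ ⊗ r 0}) ⟨
        [ μ′ ℕ.+ 1 ]q ⊗ r N ⊕ q^ μ′ ⊗ r 0                      ≡⟨ cong₂ (λ m m′ → [ m ]q ⊗ r N ⊕ q^ m′ ⊗ r 0) (trans μ≡ (ℕ.+-comm 1 μ′)) (cong (ℕ._∸ 1) μ≡) ⟨
        [ leftDegree N ]q ⊗ r N ⊕ q^ (leftDegree N ℕ.∸ 1) ⊗ r 0 ∎)
      where
      μ′ = leftCount N (suc x) f
      μ≡ : leftDegree N ≡ suc μ′
      μ≡ = ≡.begin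
        leftCount N 0 (suc (x ℕ.+ f))       ≡.≡⟨ tally-first (λ p → J? p N) 0 (x ℕ.+ f) J-base ⟩
        suc (leftCount N 1 (x ℕ.+ f))       ≡.≡⟨ cong suc (tally-+ (λ p → J? p N) 1 x f) ⟩
        suc (leftCount N 1 x ℕ.+ μ′)        ≡.≡⟨ cong (λ m → suc (m ℕ.+ μ′)) (tally-none (λ p → J? p N) 1 x λ p 0<p p<g Jp → noncrossing 0<p p<g g<N ℕ.≤-refl J0g Jp) ⟩
        suc μ′                              ≡.∎

    first-relation : Weight 0 1 (rightDegree 0) × r 1 ≈ r N ⊕ [ rightDegree 0 ]q ⊗ r 0
    first-relation with W , r-1 ← right-fan (N ℕ.∸ 1) (<-wellFounded _) 0 N 0 (ℕ.m+[n∸m]≡n (ℕ.<⇒≤ 2≤N)) ℕ.≤-refl J-base base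
      = W , ≈-trans r-1 (⊕-cong (≈-refl {r N}) (⊗-cong (⊗-identityˡ [ rightDegree 0 ]q) (≈-refl {r 0})))

    -- Each new label is `r a` plus a term `q^x r b` without constant term: on the base edge because
    -- `r 0` vanishes, deeper down because the exponent is positive.
    coeff₀-below : ∀ d → Acc ℕ._<_ d → ∀ {b a x} → b ℕ.+ d ≡ a → a ℕ.≤ N → J b a → Weight b a x →
      coeff (q^ x ⊗ r b) 0 ≡ 0ℤ → coeff (r a) 0 ≡ 1ℤ → ∀ j → b ℕ.< j → j ℕ.≤ a → coeff (r j) 0 ≡ 1ℤ
    coeff₀-below d (acc rs) {b} {a} {x} refl a≤N Jba W b₀ a₀ j b<j j≤a with ℕ.m≤n⇒m<n∨m≡n j≤a
    ... | inj₂ refl = a₀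
    ... | inj₁ j<a
      with g , b<g , g<a , Jbg , Jga ← apex (ℕ.≤-trans (s≤s b<j) j<a) a≤N Jba
      with r-g , W₁ , W₂ ← cell b<g g<a a≤N Jbg Jga Jba W
      with y , eqy ← ℕ.m≤n⇒∃[o]m+o≡n (ℕ.<⇒≤ b<g)
      with z , eqz ← ℕ.m≤n⇒∃[o]m+o≡n (ℕ.<⇒≤ g<a)
      with j ℕ.≤? g
    ... | yes j≤g = coeff₀-below y (rs (ℕ.+-cancelˡ-< b y d (subst (ℕ._< a) (sym eqy) g<a))) eqy (ℕ.≤-trans (ℕ.<⇒≤ g<a) a≤N) Jbg W₂
                      (coeff₀-q^suc x (r b)) g₀ j b<j j≤g
      where
      g₀ : coeff (r g) 0 ≡ 1ℤ
      g₀ = ≡.begin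
        coeff (r g) 0                             ≡.≡⟨ _≈_.coeff-≡ r-g 0 ⟩
        coeff (r a ⊕ q^ x ⊗ r b) 0                ≡.≡⟨ coeff-⊕ (r a) (q^ x ⊗ r b) 0 ⟩
        coeff (r a) 0 + coeff (q^ x ⊗ r b) 0      ≡.≡⟨ cong₂ _+_ a₀ b₀ ⟩
        1ℤ                                        ≡.∎
    ... | no j≰g = coeff₀-below z (rs (ℕ.+-cancelˡ-< g z d (subst (ℕ._< g ℕ.+ d) (sym eqz) (ℕ.+-monoˡ-< d b<g)))) eqz a≤N Jga W₁
                      (coeff₀-q^suc 0 (r g)) a₀ j (ℕ.≰⇒> j≰g) j≤a

    coeff₀ : r 0 ≈ 0# → r N ≈ 1# → ∀ j → 0 ℕ.< j → j ℕ.≤ N → coeff (r j) 0 ≡ 1ℤ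
    coeff₀ r₀ r-N = coeff₀-below N (<-wellFounded N) refl ℕ.≤-refl J-base base
      (_≈_.coeff-≡ (≈-trans (⊗-identityˡ (r 0)) r₀) 0) (_≈_.coeff-≡ r-N 0)

  -- The recurrence of the scaled labels.

  -- q^(sideDegree k) is the weight of the side {k, k + 1}.
  sideDegree : ℕ → ℕ
  sideDegree zero    = rightDegree 0 ℕ.∸ 1
  sideDegree (suc k) = rightDegree (suc k)

  -- The neighbour `N` across the base edge makes the degree positive, so the truncated subtraction
  -- in `sideDegree` is exact.
  rightDegree₀ : rightDegree 0 ≡ suc (sideDegree 0)
  rightDegree₀ = trans eq (cong (λ x → suc (x ℕ.∸ 1)) (sym eq))
    where
    eq : rightDegree 0 ≡ suc (rightCount 0 2 (N ℕ.∸ 2))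
    eq = trans (cong (rightCount 0 2) (ℕ.+-∸-assoc 1 2≤N))
      (tally-last (J? 0) 2 (N ℕ.∸ 2) (subst (J 0) (sym (ℕ.m+[n∸m]≡n 2≤N)) J-base))

  module _ {Weight : ℕ → ℕ → ℕ → Set} {r : ℕ → Poly} (L : Labelling Weight r)
           (functional : ∀ {b a x y} → Weight b a x → Weight b a y → x ≡ y) where

    -- The right fan at `k` computes the weight that the left fan at `k + 1` merely produces as some
    -- `e`; `functional` identifies the two exponents.
    side-weight : ∀ k → k ℕ.< N → Weight k (suc k) (suc (sideDegree k))
    side-weight zero    0<N = subst (Weight 0 1) rightDegree₀ (proj₁ (first-relation L))
    side-weight (suc k) k<N = proj₁ (right-of-apical L (s≤s z≤n) k<N (apical L (suc k) (s≤s z≤n) k<N))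

    -- `c k`, `δ k` and `Λ k` stand for `c_{i+k}`, `μ_{i,i+k}` and `ℓ_{i,i+k-1}`. The delay in `Λ`
    -- pairs `q^ℓ_{i,j}` with the label of `v_{j+1}`.
    module _ (c δ Λ : ℕ → ℕ)
      (c-first : c 0 ≡ rightDegree 0)
      (c-inner : ∀ k → suc k ℕ.< N → c (suc k) ≡ leftDegree (suc k) ℕ.+ suc (rightDegree (suc k)))
      (c-last  : c N ≡ leftDegree N)
      (δ-first : δ 0 ≡ 0)
      (δ-inner : ∀ k → suc k ℕ.< N → δ (suc k) ≡ leftDegree (suc k))
      (δ-last  : δ N ≡ leftDegree N ℕ.∸ 1)
      (Λ-start : Λ 0 ≡ 0)
      (Λ-step  : ∀ k → k ℕ.≤ N → Λ (suc k) ≡ Λ k ℕ.+ δ k)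
      where

      scaled : ℕ → Poly
      scaled p = q^ Λ p ⊗ r p

      -- This splitting turns the side weights of the fan relation into the exponents `c − 1` of the
      -- continuant: `δ k` is absorbed by the increment of `Λ`.
      c∸1 : ∀ k → k ℕ.< N → c k ℕ.∸ 1 ≡ δ k ℕ.+ sideDegree k
      c∸1 zero    k<N rewrite c-first | δ-first = refl
      c∸1 (suc k) k<N rewrite c-inner k k<N | δ-inner k k<N =
        cong (ℕ._∸ 1) (ℕ.+-suc (leftDegree (suc k)) (rightDegree (suc k)))

      relation-inner : ∀ k → suc k ℕ.< N →
        q^ δ (suc k) ⊗ r (2 ℕ.+ k) ⊕ q^ sideDegree k ⊗ r k ≈ [ c (suc k) ]q ⊗ r (suc k)
      relation-inner k k<N = begin
        q^ δ (suc k) ⊗ r (2 ℕ.+ k) ⊕ q^ sideDegree k ⊗ r k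
          ≡⟨ cong₂ (λ x y → q^ x ⊗ r (2 ℕ.+ k) ⊕ q^ y ⊗ r k) (δ-inner k k<N) (sym e≡) ⟩
        q^ leftDegree (suc k) ⊗ r (2 ℕ.+ k) ⊕ q^ e ⊗ r k
          ≈⟨ proj₂ (proj₂ relation) ⟩
        [ leftDegree (suc k) ℕ.+ suc (rightDegree (suc k)) ]q ⊗ r (suc k)
          ≡⟨ cong (λ x → [ x ]q ⊗ r (suc k)) (c-inner k k<N) ⟨
        [ c (suc k) ]q ⊗ r (suc k) ∎
        where
        relation = inner-relation L k k<N
        e = proj₁ relation
        e≡ : e ≡ sideDegree k
        e≡ = ℕ.suc-injective (functional (proj₁ (proj₂ relation)) (side-weight k (ℕ.<⇒≤ k<N)))

      -- The fan at the last vertex leaves a multiple of `r 0` with exponent `leftDegree − 1`. This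
      -- equals the descendant degree there, so `r (suc N) = −r 0` cancels it.
      relation-last : r (suc N) ≈ -1ℤ · r 0 → ∀ k → suc k ≡ N →
        q^ δ (suc k) ⊗ r (2 ℕ.+ k) ⊕ q^ sideDegree k ⊗ r k ≈ [ c (suc k) ]q ⊗ r (suc k)
      relation-last r-N+1 k k+1≡N = begin
        q^ δ (suc k) ⊗ r (2 ℕ.+ k) ⊕ q^ sideDegree k ⊗ r k
          ≡⟨ cong₂ (λ x y → q^ x ⊗ r (2 ℕ.+ k) ⊕ q^ y ⊗ r k)
               (subst (λ j → δ j ≡ leftDegree j ℕ.∸ 1) (sym k+1≡N) δ-last) (sym e≡) ⟩
        s ⊗ r (2 ℕ.+ k) ⊕ q^ e ⊗ r k
          ≈⟨ ⊕-cong (⊗-congʳ s (≈-trans (≈-reflexive (cong (λ j → r (suc j)) k+1≡N)) r-N+1)) (proj₂ (proj₂ relation)) ⟩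
        s ⊗ (-1ℤ · r 0) ⊕ (m ⊗ r (suc k) ⊕ s ⊗ r 0)
          ≈⟨ solve 5 (λ s o′ m n o → s :* o′ :+ (m :* n :+ s :* o) := m :* n :+ s :* (o :+ o′)) ≈-refl s (-1ℤ · r 0) m (r (suc k)) (r 0) ⟩
        m ⊗ r (suc k) ⊕ s ⊗ (r 0 ⊖ r 0)
          ≈⟨ ⊕-cong (≈-refl {m ⊗ r (suc k)}) (⊗-congʳ s (⊕-inverseʳ (r 0))) ⟩
        m ⊗ r (suc k) ⊕ s ⊗ 0#
          ≈⟨ solve 3 (λ m n s → m :* n :+ s :* con 0 := m :* n) ≈-refl m (r (suc k)) s ⟩
        m ⊗ r (suc k)
          ≡⟨ cong (λ x → [ x ]q ⊗ r (suc k)) (subst (λ j → c j ≡ leftDegree j) (sym k+1≡N) c-last) ⟨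
        [ c (suc k) ]q ⊗ r (suc k) ∎
        where
        s = q^ (leftDegree (suc k) ℕ.∸ 1)
        m = [ leftDegree (suc k) ]q
        relation = last-relation L k k+1≡N
        e = proj₁ relation
        e≡ : e ≡ sideDegree k
        e≡ = ℕ.suc-injective (functional (proj₁ (proj₂ relation)) (side-weight k (ℕ.≤-reflexive k+1≡N)))

      -- The fan relation multiplied by `q^Λ (suc k)`, using `Λ (2 + k) = Λ (1 + k) + δ (1 + k)` in
      -- one term and `Λ (1 + k) = Λ k + δ k` in the other.
      scaled-rec : ∀ k → k ℕ.< N →
        q^ δ (suc k) ⊗ r (2 ℕ.+ k) ⊕ q^ sideDegree k ⊗ r k ≈ [ c (suc k) ]q ⊗ r (suc k) →
        scaled (2 ℕ.+ k) ⊕ q^ (c k ℕ.∸ 1) ⊗ scaled k ≈ [ c (suc k) ]q ⊗ scaled (suc k)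
      scaled-rec k k<N rel = begin
        q^ Λ (2 ℕ.+ k) ⊗ r (2 ℕ.+ k) ⊕ q^ (c k ℕ.∸ 1) ⊗ (q^ Λ k ⊗ r k)
          ≡⟨ cong₂ (λ x y → q^ x ⊗ r (2 ℕ.+ k) ⊕ q^ y ⊗ (q^ Λ k ⊗ r k)) (Λ-step (suc k) k<N) (c∸1 k k<N) ⟩
        q^ (Λ (suc k) ℕ.+ δ (suc k)) ⊗ r (2 ℕ.+ k) ⊕ q^ (δ k ℕ.+ sideDegree k) ⊗ (q^ Λ k ⊗ r k)
          ≈⟨ ⊕-cong (⊗-cong (q^-+ (Λ (suc k)) (δ (suc k))) (≈-refl {r (2 ℕ.+ k)})) (⊗-cong (q^-+ (δ k) (sideDegree k)) (≈-refl {q^ Λ k ⊗ r k})) ⟩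
        t ⊗ q^ δ (suc k) ⊗ r (2 ℕ.+ k) ⊕ q^ δ k ⊗ κ ⊗ (q^ Λ k ⊗ r k)
          ≈⟨ solve 7 (λ t d r₂ d′ κ l r₀ → t :* d :* r₂ :+ d′ :* κ :* (l :* r₀) := t :* (d :* r₂) :+ (l :* d′) :* (κ :* r₀)) ≈-refl t (q^ δ (suc k)) (r (2 ℕ.+ k)) (q^ δ k) κ (q^ Λ k) (r k) ⟩
        t ⊗ (q^ δ (suc k) ⊗ r (2 ℕ.+ k)) ⊕ (q^ Λ k ⊗ q^ δ k) ⊗ (κ ⊗ r k)
          ≈⟨ ⊕-cong (≈-refl {t ⊗ (q^ δ (suc k) ⊗ r (2 ℕ.+ k))}) (⊗-cong (≈-trans (≈-reflexive (cong q^_ (Λ-step k (ℕ.<⇒≤ k<N)))) (q^-+ (Λ k) (δ k))) (≈-refl {κ ⊗ r k})) ⟨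
        t ⊗ (q^ δ (suc k) ⊗ r (2 ℕ.+ k)) ⊕ t ⊗ (κ ⊗ r k)
          ≈⟨ ⊗-distribˡ t _ _ ⟨
        t ⊗ (q^ δ (suc k) ⊗ r (2 ℕ.+ k) ⊕ κ ⊗ r k)
          ≈⟨ ⊗-congʳ t rel ⟩
        t ⊗ ([ c (suc k) ]q ⊗ r (suc k))
          ≈⟨ solve 3 (λ t e x → t :* (e :* x) := e :* (t :* x)) ≈-refl t [ c (suc k) ]q (r (suc k)) ⟩
        [ c (suc k) ]q ⊗ (t ⊗ r (suc k)) ∎
        where
        t = q^ Λ (suc k)
        κ = q^ sideDegree k

      recurrence-inner : ∀ k → suc k ℕ.< N →
        scaled (2 ℕ.+ k) ⊕ q^ (c k ℕ.∸ 1) ⊗ scaled k ≈ [ c (suc k) ]q ⊗ scaled (suc k)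
      recurrence-inner k k<N = scaled-rec k (ℕ.<⇒≤ k<N) (relation-inner k k<N)

      recurrence : r (suc N) ≈ -1ℤ · r 0 → ∀ k → k ℕ.< N →
        scaled (2 ℕ.+ k) ⊕ q^ (c k ℕ.∸ 1) ⊗ scaled k ≈ [ c (suc k) ]q ⊗ scaled (suc k)
      recurrence r-N+1 k k<N with ℕ.m≤n⇒m<n∨m≡n k<N
      ... | inj₁ k<N′ = recurrence-inner k k<N′
      ... | inj₂ eq   = scaled-rec k k<N (relation-last r-N+1 k eq)

      scaled₀ : scaled 0 ≈ r 0
      scaled₀ = ≈-trans (⊗-cong (≈-reflexive (cong q^_ Λ-start)) (≈-refl {r 0})) (⊗-identityˡ (r 0))

      scaled₁ : scaled 1 ≈ r N ⊕ [ c 0 ]q ⊗ r 0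
      scaled₁ = begin
        q^ Λ 1 ⊗ r 1                       ≡⟨ cong (λ x → q^ x ⊗ r 1) (trans (Λ-step 0 z≤n) (cong₂ ℕ._+_ Λ-start δ-first)) ⟩
        1# ⊗ r 1                           ≈⟨ ⊗-identityˡ (r 1) ⟩
        r 1                                ≈⟨ proj₂ (first-relation L) ⟩
        r N ⊕ [ rightDegree 0 ]q ⊗ r 0     ≡⟨ cong (λ x → r N ⊕ [ x ]q ⊗ r 0) c-first ⟨
        r N ⊕ [ c 0 ]q ⊗ r 0               ∎

      scaled₁-denominator : r 0 ≈ 0# → r N ≈ 1# → scaled 1 ≈ 1#
      scaled₁-denominator r₀ r-N = begin
        scaled 1                      ≈⟨ scaled₁ ⟩
        r N ⊕ [ c 0 ]q ⊗ r 0          ≈⟨ ⊕-cong r-N (⊗-congʳ [ c 0 ]q r₀) ⟩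
        1# ⊕ [ c 0 ]q ⊗ 0#            ≈⟨ ⊕-cong (≈-refl {1#}) (⊗-zeroʳ [ c 0 ]q) ⟩
        1#                            ∎

      denominator-continuant : r 0 ≈ 0# → r N ≈ 1# → r (suc N) ≈ -1ℤ · r 0 →
        ∀ m → m ℕ.≤ suc N → scaled m ≈ continuant c m
      denominator-continuant r₀ r-N r-N+1 = continuant-unique c scaled N
        (≈-trans scaled₀ r₀) (scaled₁-denominator r₀ r-N) (recurrence r-N+1)

      -- The `N − 1` relations at inner vertices reach index `N`, and there each continuant is a
      -- power of q times a polynomial with constant term 1.
      denominator-nonZeroDivisor : r 0 ≈ 0# → r N ≈ 1# →
        ∀ m → m ℕ.≤ N → 1 ℕ.≤ m → NonZeroDivisor (continuant c m)
      denominator-nonZeroDivisor r₀ r-N m m≤N 1≤m = nonZeroDivisor-resp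
        (continuant-unique c scaled (N ℕ.∸ 1) (≈-trans scaled₀ r₀) (scaled₁-denominator r₀ r-N)
          (λ k k< → recurrence-inner k (subst (suc (suc k) ℕ.≤_) N≡ (s≤s k<)))
          m (subst (m ℕ.≤_) (sym N≡) m≤N))
        (nonZeroDivisor-⊗ (q^ Λ m) (r m) (nonZeroDivisor-q^ (Λ m))
          (nonZeroDivisor-coeff₀ (r m) (coeff₀ L r₀ r-N m 1≤m m≤N)))
        where
        N≡ : suc (N ℕ.∸ 1) ≡ N
        N≡ = ℕ.m+[n∸m]≡n (ℕ.<⇒≤ 2≤N)

      -- Prepending 0 to the scaled numerators gives the initial values 0, 1 of a continuant begun
      -- one vertex earlier. The extra first relation is the fan at vertex 0, where `r N = 0`.
      numerator-continuant : ∀ f → (∀ k → f (suc k) ≡ c k) →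
        r 0 ≈ 1# → r N ≈ 0# → r (suc N) ≈ -1ℤ · r 0 →
        ∀ m → m ℕ.≤ suc N → scaled m ≈ continuant f (suc m)
      numerator-continuant f f≡ r₀ r-N r-N+1 m m≤N+1 = continuant-unique f y (suc N) ≈-refl (≈-trans scaled₀ r₀) rec (suc m) (s≤s m≤N+1)
        where
        y : ℕ → Poly
        y zero    = 0#
        y (suc p) = scaled p
        rec : ∀ k → k ℕ.< suc N → y (2 ℕ.+ k) ⊕ q^ (f k ℕ.∸ 1) ⊗ y k ≈ [ f (suc k) ]q ⊗ y (suc k)
        rec zero    _ = begin
          scaled 1 ⊕ T ⊗ 0#             ≈⟨ ⊕-cong scaled₁ (⊗-zeroʳ T) ⟩
          (r N ⊕ [ c 0 ]q ⊗ r 0) ⊕ 0#   ≈⟨ ⊕-identityʳ _ ⟩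
          r N ⊕ [ c 0 ]q ⊗ r 0          ≈⟨ ⊕-cong r-N (⊗-congʳ [ c 0 ]q (≈-sym scaled₀)) ⟩
          [ c 0 ]q ⊗ scaled 0           ≡⟨ cong (λ x → [ x ]q ⊗ scaled 0) (f≡ 0) ⟨
          [ f 1 ]q ⊗ scaled 0           ∎
          where T = q^ (f 0 ℕ.∸ 1)
        rec (suc k) (s≤s k<N) rewrite f≡ k | f≡ (suc k) = recurrence r-N+1 k k<N

  -- Construction of a labelling.

  -- Labels and weight on the segment `{b, a}` are arbitrary, so that the recursion can prescribe on
  -- the two other sides of a cell what its rule dictates.
  record SubLabelling (b a x : ℕ) (rb ra : Poly) : Set where
    field
      w : ℕ → ℕ → ℕ
      r : ℕ → Poly
      w-base : w b a ≡ x
      r-b : r b ≡ rb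
      r-a : r a ≡ ra
      cell : ∀ {b′ g a′} → b ℕ.≤ b′ → b′ ℕ.< g → g ℕ.< a′ → a′ ℕ.≤ a → J b′ g → J g a′ → J b′ a′ →
        CellRule (r g) (r a′) (r b′) (w b′ a′) (w g a′) (w b′ g)

  glue-labellings : ∀ {b g a x rb ra} → b ℕ.< g → g ℕ.< a → a ℕ.≤ N → J b g → J g a →
    let rg = ra ⊕ q^ x ⊗ rb in
    SubLabelling b g (suc x) rb rg → SubLabelling g a 1 rg ra → SubLabelling b a x rb ra
  glue-labellings {b} {g} {a} {x} {rb} {ra} b<g g<a a≤N Jbg Jga S₁ S₂ = record
    { w = w ; r = r
    ; w-base = trans (glue-> g<a) (glue-≤ (b<g))
    ; r-b = trans (glue-≤ (ℕ.<⇒≤ b<g)) S₁.r-b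
    ; r-a = trans (glue-> g<a) S₂.r-a
    ; cell = cell }
    where
    module S₁ = SubLabelling S₁
    module S₂ = SubLabelling S₂
    infixr 5 _⟨≤⟩_
    _⟨≤⟩_ = ℕ.≤-trans
    w : ℕ → ℕ → ℕ
    -- The middle value concerns segments straddling `g`; by `top-only` the only one occurring in a
    -- cell is `{b, a}`, of weight `x`.
    w p p′ = glue g p′ (S₁.w p p′) (glue g (suc p) x (S₂.w p p′))
    r : ℕ → Poly
    r p = glue g p (S₁.r p) (S₂.r p)
    w₁ : ∀ {p p′} → p′ ℕ.≤ g → w p p′ ≡ S₁.w p p′
    w₁ = glue-≤
    w₂ : ∀ {p p′} → g ℕ.≤ p → p ℕ.< p′ → w p p′ ≡ S₂.w p p′
    w₂ g≤p p<p′ = trans (glue-> (s≤s g≤p ⟨≤⟩ p<p′)) (glue-> (s≤s g≤p))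
    r₁ : ∀ {p} → p ℕ.≤ g → r p ≡ S₁.r p
    r₁ = glue-≤
    r₂ : ∀ {p} → g ℕ.≤ p → r p ≡ S₂.r p
    r₂ g≤p with ℕ.m≤n⇒m<n∨m≡n g≤p
    ... | inj₁ g<p  = glue-> g<p
    ... | inj₂ refl = trans (r₁ ℕ.≤-refl) (trans S₁.r-a (sym S₂.r-b))
    left-cell : ∀ {b′ g′ a′} → b ℕ.≤ b′ → b′ ℕ.< g′ → g′ ℕ.< a′ → a′ ℕ.≤ g → J b′ g′ → J g′ a′ → J b′ a′ →
      CellRule (r g′) (r a′) (r b′) (w b′ a′) (w g′ a′) (w b′ g′)
    left-cell b≤b′ b′<g′ g′<a′ a′≤g Jbg′ Jga′ Jba′ = cellRule-resp
      (r₁ g′≤g) (r₁ a′≤g) (r₁ (ℕ.<⇒≤ b′<g′ ⟨≤⟩ g′≤g)) (w₁ a′≤g) (w₁ a′≤g) (w₁ g′≤g)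
      (S₁.cell b≤b′ b′<g′ g′<a′ a′≤g Jbg′ Jga′ Jba′)
      where g′≤g = ℕ.<⇒≤ g′<a′ ⟨≤⟩ a′≤g
    right-cell : ∀ {b′ g′ a′} → g ℕ.≤ b′ → b′ ℕ.< g′ → g′ ℕ.< a′ → a′ ℕ.≤ a → J b′ g′ → J g′ a′ → J b′ a′ →
      CellRule (r g′) (r a′) (r b′) (w b′ a′) (w g′ a′) (w b′ g′)
    right-cell g≤b′ b′<g′ g′<a′ a′≤a Jbg′ Jga′ Jba′ = cellRule-resp
      (r₂ g≤g′) (r₂ (g≤g′ ⟨≤⟩ ℕ.<⇒≤ g′<a′)) (r₂ g≤b′) (w₂ g≤b′ (ℕ.<-trans b′<g′ g′<a′)) (w₂ g≤g′ g′<a′) (w₂ g≤b′ b′<g′)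
      (S₂.cell g≤b′ b′<g′ g′<a′ a′≤a Jbg′ Jga′ Jba′)
      where g≤g′ = g≤b′ ⟨≤⟩ ℕ.<⇒≤ b′<g′
    top-cell : CellRule (r g) (r a) (r b) (w b a) (w g a) (w b g)
    top-cell = cellRule-resp
      (trans (r₁ ℕ.≤-refl) S₁.r-a) (trans (r₂ (ℕ.<⇒≤ g<a)) S₂.r-a) (trans (r₁ (ℕ.<⇒≤ b<g)) S₁.r-b)
      (trans (glue-> g<a) (glue-≤ b<g)) (trans (w₂ ℕ.≤-refl g<a) S₂.w-base) (trans (w₁ ℕ.≤-refl) S₁.w-base)
      (≈-refl , refl , refl)
    -- The long side of a cell straddling `g` would cross `{b, g}` or `{g, a}` unless it is
    -- `{b, a}`; an apex other than `g` then gives such a crossing again.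
    top-only : ∀ {b′ g′ a′} → b ℕ.≤ b′ → b′ ℕ.< g′ → g′ ℕ.< a′ → a′ ℕ.≤ a → b′ ℕ.< g → g ℕ.< a′ →
      J b′ g′ → J g′ a′ → J b′ a′ → b′ ≡ b × g′ ≡ g × a′ ≡ a
    top-only {g′ = g′} b≤b′ b′<g′ g′<a′ a′≤a b′<g g<a′ Jbg′ Jga′ Jba′
      with ℕ.m≤n⇒m<n∨m≡n b≤b′ | ℕ.m≤n⇒m<n∨m≡n a′≤a | ℕ.<-cmp g′ g
    ... | inj₁ b<b′ | _ | _ = ⊥-elim (noncrossing b<b′ b′<g g<a′ (a′≤a ⟨≤⟩ a≤N) Jbg Jba′)
    ... | inj₂ refl | inj₁ a′<a | _ = ⊥-elim (noncrossing b′<g g<a′ a′<a a≤N Jba′ Jga)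
    ... | inj₂ refl | inj₂ refl | tri< g′<g _ _ = ⊥-elim (noncrossing b′<g′ g′<g g<a a≤N Jbg Jga′)
    ... | inj₂ refl | inj₂ refl | tri> _ _ g<g′ = ⊥-elim (noncrossing b<g g<g′ g′<a′ a≤N Jbg′ Jga)
    ... | inj₂ refl | inj₂ refl | tri≈ _ refl _ = refl , refl , refl
    cell : ∀ {b′ g′ a′} → b ℕ.≤ b′ → b′ ℕ.< g′ → g′ ℕ.< a′ → a′ ℕ.≤ a → J b′ g′ → J g′ a′ → J b′ a′ →
      CellRule (r g′) (r a′) (r b′) (w b′ a′) (w g′ a′) (w b′ g′)
    cell {b′} {g′} {a′} b≤b′ b′<g′ g′<a′ a′≤a Jbg′ Jga′ Jba′ = [
      (λ a′≤g → left-cell b≤b′ b′<g′ g′<a′ a′≤g Jbg′ Jga′ Jba′) ,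
      (λ g<a′ → [ (λ g≤b′ → right-cell g≤b′ b′<g′ g′<a′ a′≤a Jbg′ Jga′ Jba′) ,
                  (λ b′<g → top b′<g g<a′) ]′ (ℕ.≤-<-connex g b′)) ]′ (ℕ.≤-<-connex a′ g)
      where
      top : b′ ℕ.< g → g ℕ.< a′ → CellRule (r g′) (r a′) (r b′) (w b′ a′) (w g′ a′) (w b′ g′)
      top b′<g g<a′ with refl , refl , refl ← top-only b≤b′ b′<g′ g′<a′ a′≤a b′<g g<a′ Jbg′ Jga′ Jba′ = top-cell

  subLabelling : ∀ d → Acc ℕ._<_ d → ∀ {b a} → b ℕ.+ d ≡ a → b ℕ.< a → a ℕ.≤ N → J b a → ∀ x rb ra → SubLabelling b a x rb ra
  subLabelling d (acc rs) {b} {a} refl b<a a≤N Jba x rb ra with suc b ℕ.≟ a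
  ... | yes eq = record
    { w = λ _ _ → x ; r = λ p → glue b p rb ra
    ; w-base = refl ; r-b = glue-≤ (ℕ.≤-refl {b}) ; r-a = glue-> b<a
    ; cell = λ {b′} {g} {a′} b≤b′ b′<g g<a′ a′≤a → ⊥-elim (ℕ.<⇒≱ (ℕ.≤-<-trans (s≤s b≤b′) (ℕ.≤-<-trans b′<g g<a′)) (subst (a′ ℕ.≤_) (sym eq) a′≤a)) }
  ... | no neq
    with g , b<g , g<a , Jbg , Jga ← apex (ℕ.≤∧≢⇒< b<a neq) a≤N Jba
    with y , eqy ← ℕ.m≤n⇒∃[o]m+o≡n (ℕ.<⇒≤ b<g)
    with z , eqz ← ℕ.m≤n⇒∃[o]m+o≡n (ℕ.<⇒≤ g<a)
    = glue-labellings b<g g<a a≤N Jbg Jga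
        (subLabelling y (rs (ℕ.+-cancelˡ-< b y d (subst (ℕ._< a) (sym eqy) g<a))) eqy b<g (ℕ.≤-trans (ℕ.<⇒≤ g<a) a≤N) Jbg _ _ _)
        (subLabelling z (rs (ℕ.+-cancelˡ-< g z d (subst (ℕ._< g ℕ.+ d) (sym eqz) (ℕ.+-monoˡ-< d b<g)))) eqz g<a a≤N Jga _ _ _)

  labelling-exists : ∃₂ λ w r → Labelling (λ b a x → w b a ≡ x) r × r 0 ≈ 0# × r N ≈ 1#
  labelling-exists = w , r , record { base = w-base ; cell = λ { b<g g<a a≤N Jbg Jga Jba refl → cell z≤n b<g g<a a≤N Jbg Jga Jba } } ,
    ≈-reflexive r-b , ≈-reflexive r-a
    where open SubLabelling (subLabelling N (<-wellFounded N) refl (ℕ.<⇒≤ 2≤N) ℕ.≤-refl J-base 0 0# 1#)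

  -- The labelling is only a witness and leaves no trace in the statement; `Λ` is taken as the
  -- partial sums of `δ`.
  continuant-nonZeroDivisor : ∀ (c δ : ℕ → ℕ) →
    c 0 ≡ rightDegree 0 →
    (∀ k → suc k ℕ.< N → c (suc k) ≡ leftDegree (suc k) ℕ.+ suc (rightDegree (suc k))) →
    c N ≡ leftDegree N →
    δ 0 ≡ 0 → (∀ k → suc k ℕ.< N → δ (suc k) ≡ leftDegree (suc k)) → δ N ≡ leftDegree N ℕ.∸ 1 →
    ∀ m → m ℕ.≤ N → 1 ℕ.≤ m → NonZeroDivisor (continuant c m)
  continuant-nonZeroDivisor c δ c-first c-inner c-last δ-first δ-inner δ-last
    with w , s , L , s₀ , s-N ← labelling-exists
    = denominator-nonZeroDivisor L (λ e e′ → trans (sym e) e′) c δ cumulative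
        c-first c-inner c-last δ-first δ-inner δ-last refl (λ _ _ → refl) s₀ s-N
    where
    cumulative : ℕ → ℕ
    cumulative zero    = 0
    cumulative (suc p) = cumulative p ℕ.+ δ p

-- Non-crossing chords: an upper bound on their number.

lookup-injective : ∀ {A : Set} {xs : List A} → Unique xs → ∀ i j → lookup xs i ≡ lookup xs j → i ≡ j
lookup-injective (_ ∷ _)  Fin.zero    Fin.zero    _  = refl
lookup-injective (x∉ ∷ _) Fin.zero    (Fin.suc j) eq = ⊥-elim (All.lookup x∉ (∈-lookup j) eq)
lookup-injective (x∉ ∷ _) (Fin.suc i) Fin.zero    eq = ⊥-elim (All.lookup x∉ (∈-lookup i) (sym eq))
lookup-injective (_ ∷ u)  (Fin.suc i) (Fin.suc j) eq = cong Fin.suc (lookup-injective u i j eq)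

-- Pigeonhole on list indices. A relation suffices in place of a map, the image being chosen by its
-- index in `ys`.
length-≤ : ∀ {A B : Set} (R : A → B → Set) {xs : List A} {ys : List B} → Unique xs →
  (∀ {x} → x ∈ xs → ∃ λ y → y ∈ ys × R x y) →
  (∀ {x x′ y} → R x y → R x′ y → x ≡ x′) → length xs ℕ.≤ length ys
length-≤ R {xs} {ys} u total inj = Fin.injective⇒≤ λ {i} {j} eq → lookup-injective u i j
  (inj (related i) (subst (R (lookup xs j)) (cong (lookup ys) (sym eq)) (related j)))
  where
  image : Fin (length xs) → Fin (length ys)
  image i = Any.index (proj₁ (proj₂ (total (∈-lookup {xs = xs} i))))
  related : ∀ i → R (lookup xs i) (lookup ys (image i))
  related i = let y , y∈ , Rxy = total (∈-lookup {xs = xs} i) in subst (R (lookup xs i)) (Any.lookup-index y∈) Rxy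

unique-map : ∀ {A B : Set} {f : A → B} {xs : List A} →
  (∀ {x y} → x ∈ xs → y ∈ xs → f x ≡ f y → x ≡ y) → Unique xs → Unique (map f xs)
unique-map inj []      = []
unique-map {f = f} inj (x∉ ∷ u) =
  All.tabulate (λ z∈ fx≡z → let y , y∈ , z≡ = ∈-map⁻ f z∈ in
    All.lookup x∉ y∈ (inj (here refl) (there y∈) (trans fx≡z z≡))) ∷
  unique-map (λ x∈ y∈ → inj (there x∈) (there y∈)) u

greatest-below : ∀ {P : ℕ → Set} → Decidable P → ∀ {l} h → l ℕ.< h → P l →
  ∃ λ g → l ℕ.≤ g × g ℕ.< h × P g × (∀ {k} → g ℕ.< k → k ℕ.< h → ¬ P k)
greatest-below P? {l} (suc h) (s≤s l≤h) Pl with P? h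
... | yes Ph = h , l≤h , ℕ.≤-refl , Ph , λ h<k k≤h _ → ℕ.<⇒≱ h<k (ℕ.≤-pred k≤h)
... | no ¬Ph with ℕ.m≤n⇒m<n∨m≡n l≤h
...   | inj₂ refl = ⊥-elim (¬Ph Pl)
...   | inj₁ l<h with g , l≤g , g<h , Pg , max ← greatest-below P? h l<h Pl
  = g , l≤g , ℕ.m<n⇒m<1+n g<h , Pg , λ g<k k≤h Pk → [ (λ k<h → max g<k k<h Pk) , (λ { refl → ¬Ph Pk }) ]′ (ℕ.m≤n⇒m<n∨m≡n (ℕ.≤-pred k≤h))

-- The chord {x, y} is sent to the greatest g < y joined to x; for non-crossing chords this is
-- injective, because g recovers first x and then y.
chords-≤ : ∀ N (K : ℕ → ℕ → Set) (K? : ∀ x y → Dec (K x y)) →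
  (∀ x → x ℕ.< N → K x (suc x)) →
  (∀ {a b c d} → a ℕ.< b → b ℕ.< c → c ℕ.< d → d ℕ.≤ N → K a c → ¬ K b d) →
  ∀ {cs} → Unique cs → All (λ (x , y) → 2 ℕ.+ x ℕ.≤ y × y ℕ.≤ N × K x y) cs → length cs ℕ.≤ N ℕ.∸ 1
chords-≤ N K K? K-side noncrossing {cs} u chords =
  subst (length cs ℕ.≤_) (length-applyUpTo suc (N ℕ.∸ 1)) (length-≤ R u total injective)
  where
  R : ℕ × ℕ → ℕ → Set
  R (x , y) g = x ℕ.< g × g ℕ.< y × y ℕ.≤ N × K x g × K x y × (∀ {k} → g ℕ.< k → k ℕ.< y → ¬ K x k)
  total : ∀ {c} → c ∈ cs → ∃ λ g → g ∈ applyUpTo suc (N ℕ.∸ 1) × R c g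
  total {x , y} c∈
    with 2+x≤y , y≤N , Kxy ← All.lookup chords c∈
    with g , x<g , g<y , Kxg , max ← greatest-below (K? x) y 2+x≤y (K-side x (ℕ.≤-trans (ℕ.<⇒≤ 2+x≤y) y≤N))
    = g , member g (ℕ.≤-trans (s≤s z≤n) x<g) (ℕ.≤-trans g<y y≤N) , x<g , g<y , y≤N , Kxg , Kxy , max
    where
    member : ∀ g → 0 ℕ.< g → g ℕ.< N → g ∈ applyUpTo suc (N ℕ.∸ 1)
    member (suc g) _ g<N = ∈-applyUpTo⁺ suc (ℕ.∸-monoˡ-< g<N (s≤s z≤n))
  injective : ∀ {c c′ g} → R c g → R c′ g → c ≡ c′
  injective {x , y} {x′ , y′} (x<g , g<y , y≤N , Kxg , Kxy , max) (x′<g , g<y′ , y′≤N , Kx′g , Kx′y′ , max′)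
    with ℕ.<-cmp x x′ | ℕ.<-cmp y y′
  ... | tri< x<x′ _ _ | _ = ⊥-elim (noncrossing x<x′ x′<g g<y′ y′≤N Kxg Kx′y′)
  ... | tri> _ _ x′<x | _ = ⊥-elim (noncrossing x′<x x<g g<y y≤N Kx′g Kxy)
  ... | tri≈ _ refl _ | tri< y<y′ _ _ = ⊥-elim (max′ g<y y<y′ Kxy)
  ... | tri≈ _ refl _ | tri> _ _ y′<y = ⊥-elim (max g<y′ y′<y Kx′y′)
  ... | tri≈ _ refl _ | tri≈ _ refl _ = refl

-- Vertices modulo n.

module Residues (n : ℕ) .{{_ : NonZero n}} where
  open Polygon n

  multiple-small : ∀ t → ∣ t * + n ∣ ℕ.< n → t ≡ 0ℤ
  multiple-small t lt = ℤ.∣i∣≡0⇒i≡0 (ℕ.n<1⇒n≡0 (ℕ.*-cancelʳ-< n ∣ t ∣ 1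
    (subst₂ ℕ._<_ (ℤ.abs-* t (+ n)) (sym (ℕ.*-identityˡ n)) lt)))

  -- Two remainders differ by a multiple of `n` of absolute value below `n`, hence by 0.
  %ℕ-unique : ∀ {u k} t → k ℕ.< n → u ≡ + k + t * + n → u %ℕ n ≡ k
  %ℕ-unique {u} {k} t k<n eq = ℤ.+-injective (≡.begin
    + r                                        ≡.≡⟨ lemma (+ r) (s * + n) ⟩
    (+ r + s * + n) - s * + n                  ≡.≡⟨ cong (_- s * + n) (trans (sym (a≡a%ℕn+[a/ℕn]*n u n)) eq) ⟩
    (+ k + t * + n) - s * + n                  ≡.≡⟨ lemma′ (+ k) t s (+ n) ⟩
    + k + (t - s) * + n                        ≡.≡⟨ cong (λ x → + k + x * + n) t-s≡0 ⟩
    + k + 0ℤ * + n                             ≡.≡⟨ lemma″ (+ k) (+ n) ⟩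
    + k                                        ≡.∎)
    where
    r = u %ℕ n
    s = u /ℕ n
    lemma : ∀ a b → a ≡ (a + b) - b
    lemma = ℤSolver.solve-∀
    lemma′ : ∀ k t s n → (k + t * n) - s * n ≡ k + (t - s) * n
    lemma′ = ℤSolver.solve-∀
    lemma″ : ∀ k n → k + 0ℤ * n ≡ k
    lemma″ = ℤSolver.solve-∀
    difference : (t - s) * + n ≡ + r - + k
    difference = ≡.begin
      (t - s) * + n                                ≡.≡⟨ lemma‴ (+ k) t s (+ n) (+ r) ⟩
      (+ k + t * + n) - (+ r + s * + n) + (+ r - + k) ≡.≡⟨ cong (λ x → x - (+ r + s * + n) + (+ r - + k)) (trans (sym eq) (a≡a%ℕn+[a/ℕn]*n u n)) ⟩
      (+ r + s * + n) - (+ r + s * + n) + (+ r - + k) ≡.≡⟨ cong (_+ (+ r - + k)) (ℤ.+-inverseʳ (+ r + s * + n)) ⟩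
      0ℤ + (+ r - + k)                             ≡.≡⟨ ℤ.+-identityˡ _ ⟩
      + r - + k                                    ≡.∎
      where
      lemma‴ : ∀ k t s n r → (t - s) * n ≡ (k + t * n) - (r + s * n) + (r - k)
      lemma‴ = ℤSolver.solve-∀
    t-s≡0 : t - s ≡ 0ℤ
    t-s≡0 = multiple-small (t - s) (ℕ.≤-<-trans
      (subst (ℕ._≤ r ℕ.⊔ k) (sym (cong ∣_∣ (trans difference (ℤ.m-n≡m⊖n r k)))) (ℤ.∣m⊝n∣≤m⊔n r k))
      (ℕ.⊔-lub (n%ℕd<d u n) k<n))

  toℕ-v : ∀ {u k} t → k ℕ.< n → u ≡ + k + t * + n → toℕ (v u) ≡ k
  toℕ-v {u} t k<n eq = trans (Fin.toℕ-fromℕ< (n%ℕd<d u n)) (%ℕ-unique t k<n eq)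

  v-decompose : ∀ u → u ≡ + toℕ (v u) + (u /ℕ n) * + n
  v-decompose u = trans (a≡a%ℕn+[a/ℕn]*n u n) (cong (λ k → + k + (u /ℕ n) * + n) (sym (Fin.toℕ-fromℕ< (n%ℕd<d u n))))

  v-periodic : ∀ u t → v (u + t * + n) ≡ v u
  v-periodic u t = Fin.toℕ-injective (toℕ-v (t + u /ℕ n) (Fin.toℕ<n (v u))
    (trans (cong (_+ t * + n) (v-decompose u)) (lemma (+ toℕ (v u)) (u /ℕ n) t (+ n))))
    where
    lemma : ∀ k s t n → k + s * n + t * n ≡ k + (t + s) * n
    lemma = ℤSolver.solve-∀

  v-toℕ : ∀ x → v (+ toℕ x) ≡ x
  v-toℕ x = Fin.toℕ-injective (toℕ-v 0ℤ (Fin.toℕ<n x) (lemma (+ toℕ x) (+ n)))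
    where
    lemma : ∀ k n → k ≡ k + 0ℤ * n
    lemma = ℤSolver.solve-∀

  v-congruent : ∀ {u u′} → v u ≡ v u′ → ∃ λ t → u ≡ u′ + t * + n
  v-congruent {u} {u′} eq = u /ℕ n - u′ /ℕ n , (≡.begin
    u                                                     ≡.≡⟨ v-decompose u ⟩
    + toℕ (v u) + (u /ℕ n) * + n                          ≡.≡⟨ cong (λ x → + toℕ x + (u /ℕ n) * + n) eq ⟩
    + toℕ (v u′) + (u /ℕ n) * + n                         ≡.≡⟨ lemma (+ toℕ (v u′)) (u /ℕ n) (u′ /ℕ n) (+ n) ⟩
    + toℕ (v u′) + (u′ /ℕ n) * + n + (u /ℕ n - u′ /ℕ n) * + n ≡.≡⟨ cong (_+ (u /ℕ n - u′ /ℕ n) * + n) (v-decompose u′) ⟨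
    u′ + (u /ℕ n - u′ /ℕ n) * + n                         ≡.∎)
    where
    lemma : ∀ k s t n → k + s * n ≡ k + t * n + (s - t) * n
    lemma = ℤSolver.solve-∀

  next-v : ∀ u → next (v u) ≡ v (u + 1ℤ)
  next-v u = sym (trans (cong v (trans (cong (_+ 1ℤ) (v-decompose u)) (lemma (+ toℕ (v u)) (u /ℕ n) (+ n)))) (v-periodic (+ suc (toℕ (v u))) (u /ℕ n)))
    where
    lemma : ∀ k s n → k + s * n + 1ℤ ≡ (1ℤ + k) + s * n
    lemma = ℤSolver.solve-∀

-- Positions relative to a base vertex, and the existence of cells.

module Joins (n : ℕ) .{{_ : NonZero n}} (3≤n : 3 ℕ.≤ n) (𝕋 : Triangulation n) where
  open Polygon n
  open Residues n
  open Triangulation 𝕋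

  N : ℕ
  N = n ℕ.∸ 1

  1+N≡n : suc N ≡ n
  1+N≡n = ℕ.m+[n∸m]≡n (ℕ.≤-trans (s≤s z≤n) 3≤n)

  2≤N : 2 ℕ.≤ N
  2≤N = ℕ.∸-monoˡ-≤ 1 3≤n

  side-sym : ∀ {x y} → Side x y → Side y x
  side-sym = swap

  joined-sym : ∀ {x y} → Joined x y → Joined y x
  joined-sym = Sum.map swap swap

  diagonal-not-side : ∀ {x y} → Side x y → ¬ Diagonal x y
  diagonal-not-side side (inj₁ xy∈) = proj₂ (All.lookup proper xy∈) side
  diagonal-not-side side (inj₂ yx∈) = proj₂ (All.lookup proper yx∈) (side-sym side)

  module At (i : ℤ) where

    V : ℕ → Fin n
    V p = v (i + + p)

    J : ℕ → ℕ → Set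
    J p q = Joined (V p) (V q)

    J? : ∀ p q → Dec (J p q)
    J? p q = joined? (V p) (V q)

    V-periodic : ∀ p → V (p ℕ.+ n) ≡ V p
    V-periodic p = trans (cong v (lemma i (+ p) (+ n))) (v-periodic (i + + p) 1ℤ)
      where
      lemma : ∀ i p n → i + (p + n) ≡ i + p + 1ℤ * n
      lemma = ℤSolver.solve-∀

    V-next : ∀ p → next (V p) ≡ V (suc p)
    V-next p = trans (next-v (i + + p)) (cong v (lemma i (+ p)))
      where
      lemma : ∀ i p → i + p + 1ℤ ≡ i + (1ℤ + p)
      lemma = ℤSolver.solve-∀

    V-distinct : ∀ {p q} → p ℕ.< q → q ℕ.< p ℕ.+ n → V p ≢ V q
    V-distinct {p} {q} p<q q<p+n eq with d , refl ← ℕ.m≤n⇒∃[o]m+o≡n p<q | t , i+q≡ ← v-congruent {i + + q} {i + + p} (sym eq)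
      = ⊥-elim (ℕ.1+n≢0 (ℤ.+-injective (trans d≡ (trans (cong (_* + n) t≡0) (ℤ.*-zeroˡ (+ n))))))
      where
      d≡ : + suc d ≡ t * + n
      d≡ = ≡.begin
        + suc d                                  ≡.≡⟨ lemma i (+ p) (+ d) ⟩
        i + (1ℤ + + p + + d) - (i + + p)         ≡.≡⟨ cong (_- (i + + p)) i+q≡ ⟩
        (i + + p) + t * + n - (i + + p)          ≡.≡⟨ lemma′ (i + + p) (t * + n) ⟩
        t * + n                                  ≡.∎
        where
        lemma : ∀ i p d → 1ℤ + d ≡ i + (1ℤ + p + d) - (i + p)
        lemma = ℤSolver.solve-∀
        lemma′ : ∀ a b → a + b - a ≡ b
        lemma′ = ℤSolver.solve-∀
      t≡0 : t ≡ 0ℤ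
      t≡0 = multiple-small t (subst (ℕ._< n) (cong ∣_∣ d≡)
        (ℕ.+-cancelˡ-< p (suc d) n (subst (ℕ._< p ℕ.+ n) (sym (ℕ.+-suc p d)) q<p+n)))

    V-injective : ∀ {p q} → p ℕ.< n → q ℕ.< n → V p ≡ V q → p ≡ q
    V-injective {p} {q} p<n q<n eq with ℕ.<-cmp p q
    ... | tri< p<q _ _ = ⊥-elim (V-distinct p<q (ℕ.<-≤-trans q<n (ℕ.m≤n+m n p)) eq)
    ... | tri≈ _ p≡q _ = p≡q
    ... | tri> _ _ q<p = ⊥-elim (V-distinct q<p (ℕ.<-≤-trans p<n (ℕ.m≤n+m n q)) (sym eq))

    position : Fin n → ℕ
    position x = (+ toℕ x - i) %ℕ n

    position<n : ∀ x → position x ℕ.< n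
    position<n x = n%ℕd<d (+ toℕ x - i) n

    V-position : ∀ x → V (position x) ≡ x
    V-position x = trans (sym (v-periodic (i + + position x) t)) (trans (cong v (≡.begin
      i + + position x + t * + n        ≡.≡⟨ ℤ.+-assoc i (+ position x) (t * + n) ⟩
      i + (+ position x + t * + n)      ≡.≡⟨ cong (_+_ i) (a≡a%ℕn+[a/ℕn]*n (+ toℕ x - i) n) ⟨
      i + (+ toℕ x - i)                 ≡.≡⟨ lemma i (+ toℕ x) ⟩
      + toℕ x                           ≡.∎)) (v-toℕ x))
      where
      t = (+ toℕ x - i) /ℕ n
      lemma : ∀ i x → i + (x - i) ≡ x
      lemma = ℤSolver.solve-∀

    V-side : ∀ p → Side (V p) (V (suc p))
    V-side p = inj₁ (sym (V-next p))

    J-side : ∀ p → J p (suc p)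
    J-side p = inj₁ (V-side p)

    J-sym : ∀ {p q} → J p q → J q p
    J-sym = joined-sym

    base-side : Side (V 0) (V N)
    base-side = inj₂ (sym (trans (V-next N) (trans (cong V 1+N≡n) (V-periodic 0))))

    J-base : J 0 N
    J-base = inj₁ base-side

    side-cases : ∀ {p q} → p ℕ.< q → q ℕ.< p ℕ.+ n → Side (V p) (V q) → q ≡ suc p ⊎ suc q ≡ p ℕ.+ n
    side-cases {p} {q} p<q q<p+n (inj₁ eq) with ℕ.m≤n⇒m<n∨m≡n p<q
    ... | inj₁ 1+p<q = ⊥-elim (V-distinct 1+p<q (ℕ.m<n⇒m<1+n q<p+n) (trans (sym (V-next p)) (sym eq)))
    ... | inj₂ 1+p≡q = inj₁ (sym 1+p≡q)
    side-cases {p} {q} p<q q<p+n (inj₂ eq) with ℕ.m≤n⇒m<n∨m≡n q<p+n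
    ... | inj₁ 1+q<p+n = ⊥-elim (V-distinct (ℕ.m<n⇒m<1+n p<q) 1+q<p+n (trans eq (V-next q)))
    ... | inj₂ 1+q≡p+n = inj₂ 1+q≡p+n

    -- A side joins cyclic neighbours and so has no vertex strictly between its ends on one side;
    -- only two diagonals need `nonCrossing`.
    J-noncrossing : ∀ {a b c d} → a ℕ.< b → b ℕ.< c → c ℕ.< d → d ℕ.< a ℕ.+ n → J a c → ¬ J b d
    J-noncrossing {a} {b} {c} {d} a<b b<c c<d d<a+n (inj₁ s) _
      with side-cases (ℕ.<-trans a<b b<c) (ℕ.<-trans c<d d<a+n) s
    ... | inj₁ refl = ℕ.<⇒≱ a<b (ℕ.≤-pred b<c)
    ... | inj₂ eq = ℕ.<⇒≱ d<a+n (subst (ℕ._≤ d) eq c<d)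
    J-noncrossing {a} {b} {c} {d} a<b b<c c<d d<a+n _ (inj₁ s)
      with side-cases (ℕ.<-trans b<c c<d) (ℕ.<-trans d<a+n (ℕ.+-monoˡ-< n a<b)) s
    ... | inj₁ refl = ℕ.<⇒≱ b<c (ℕ.≤-pred c<d)
    ... | inj₂ eq = ℕ.<⇒≱ (ℕ.+-monoˡ-< n a<b) (subst (ℕ._≤ a ℕ.+ n) eq d<a+n)
    J-noncrossing {a} {b} {c} {d} a<b b<c c<d d<a+n (inj₂ δ) (inj₂ δ′) =
      nonCrossing (i + + a) (i + + b) (i + + c) (i + + d)
        (mono a<b) (mono b<c) (mono c<d)
        (subst (i + + d ℤ.<_) (sym (ℤ.+-assoc i (+ a) (+ n))) (mono d<a+n)) δ δ′
      where
      mono : ∀ {p q} → p ℕ.< q → i + + p ℤ.< i + + q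
      mono p<q = ℤ.+-monoʳ-< i (ℤ.+<+ p<q)

    J-noncrossing-window : ∀ {a b c d} → a ℕ.< b → b ℕ.< c → c ℕ.< d → d ℕ.≤ N → J a c → ¬ J b d
    J-noncrossing-window {a} a<b b<c c<d d≤N =
      J-noncrossing a<b b<c c<d (ℕ.<-≤-trans (subst (_ ℕ.<_) 1+N≡n (s≤s d≤N)) (ℕ.m≤n+m n a))

    diagonal-position : Fin n × Fin n → ℕ × ℕ
    diagonal-position (x , y) = position x ℕ.⊓ position y , position x ℕ.⊔ position y

    -- Diagonals are stored in the order of residues, whereas positions are ordered by distance from
    -- `v_i`; the two orders may disagree.
    DiagonalAt : Fin n × Fin n → ℕ × ℕ → Set
    DiagonalAt (x , y) (p , q) = p ℕ.< q × q ℕ.≤ N × ((V p ≡ x × V q ≡ y) ⊎ (V p ≡ y × V q ≡ x))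

    diagonal-at : ∀ {x y} → x ≢ y → DiagonalAt (x , y) (diagonal-position (x , y))
    diagonal-at {x} {y} x≢y with ℕ.<-cmp (position x) (position y)
    ... | tri< lt _ _ rewrite ℕ.m≤n⇒m⊓n≡m (ℕ.<⇒≤ lt) | ℕ.m≤n⇒m⊔n≡n (ℕ.<⇒≤ lt) =
      lt , ℕ.≤-pred (subst (position y ℕ.<_) (sym 1+N≡n) (position<n y)) , inj₁ (V-position x , V-position y)
    ... | tri> _ _ gt rewrite ℕ.m≥n⇒m⊓n≡n (ℕ.<⇒≤ gt) | ℕ.m≥n⇒m⊔n≡m (ℕ.<⇒≤ gt) =
      gt , ℕ.≤-pred (subst (position x ℕ.<_) (sym 1+N≡n) (position<n x)) , inj₂ (V-position y , V-position x)
    ... | tri≈ _ eq _ = ⊥-elim (x≢y (trans (sym (V-position x)) (trans (cong V eq) (V-position y))))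

    diagonal-at-list : ∀ {xy} → xy ∈ diagonals → DiagonalAt xy (diagonal-position xy)
    diagonal-at-list xy∈ = diagonal-at λ eq → ℕ.<⇒≢ (proj₁ (All.lookup proper xy∈)) (cong toℕ eq)

    diagonal-joined : ∀ {x y p q} → (x , y) ∈ diagonals → DiagonalAt (x , y) (p , q) → Diagonal (V p) (V q) × ¬ Side (V p) (V q)
    diagonal-joined xy∈ (_ , _ , inj₁ (refl , refl)) = inj₁ xy∈ , proj₂ (All.lookup proper xy∈)
    diagonal-joined xy∈ (_ , _ , inj₂ (refl , refl)) = inj₂ xy∈ , λ s → proj₂ (All.lookup proper xy∈) (side-sym s)

    positions : List (ℕ × ℕ)
    positions = map diagonal-position diagonals

    diagonal-at-injective : ∀ {x y x′ y′ p q} → x Fin.< y → x′ Fin.< y′ →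
      DiagonalAt (x , y) (p , q) → DiagonalAt (x′ , y′) (p , q) → (x , y) ≡ (x′ , y′)
    diagonal-at-injective _   _     (_ , _ , inj₁ (refl , refl)) (_ , _ , inj₁ (refl , refl)) = refl
    diagonal-at-injective _   _     (_ , _ , inj₂ (refl , refl)) (_ , _ , inj₂ (refl , refl)) = refl
    diagonal-at-injective x<y x′<y′ (_ , _ , inj₁ (refl , refl)) (_ , _ , inj₂ (refl , refl)) = ⊥-elim (ℕ.<-asym x<y x′<y′)
    diagonal-at-injective x<y x′<y′ (_ , _ , inj₂ (refl , refl)) (_ , _ , inj₁ (refl , refl)) = ⊥-elim (ℕ.<-asym x<y x′<y′)

    positions-unique : Unique positions
    positions-unique = unique-map
      (λ {c} {c′} c∈ c′∈ eq → diagonal-at-injective (proj₁ (All.lookup proper c∈)) (proj₁ (All.lookup proper c′∈))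
        (subst (DiagonalAt c) eq (diagonal-at-list c∈)) (diagonal-at-list c′∈))
      unique

    positions-chord : ∀ {p q} → (p , q) ∈ positions → 2 ℕ.+ p ℕ.≤ q × q ℕ.≤ N × J p q × ¬ Side (V p) (V q)
    positions-chord {p} pq∈ with c , c∈ , refl ← ∈-map⁻ diagonal-position pq∈
      with p<q , q≤N , _ ← diagonal-at-list c∈ | δ , ¬s ← diagonal-joined c∈ (diagonal-at-list c∈)
      = ℕ.≤∧≢⇒< p<q (λ eq → ¬s (subst (λ q → Side (V p) (V q)) eq (V-side p))) , q≤N , inj₂ δ , ¬s

    -- A triangulation is maximal: if the cell beyond the segment {0, a} were missing, then a new
    -- chord {g, a} could be added.
    apex₀ : ∀ {a} → 2 ℕ.≤ a → a ℕ.≤ N → J 0 a → ∃ λ g → 0 ℕ.< g × g ℕ.< a × J 0 g × J g a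
    apex₀ {a} 2≤a a≤N J0a
      with ℕ.anyUpTo? (λ g → (0 ℕ.<? g) ×-dec (J? 0 g ×-dec J? g a)) a
    ... | yes (g , g<a , 0<g , J0g , Jga) = g , 0<g , g<a , J0g , Jga
    ... | no none
      with g , 0<g , g<a , J0g , max ← greatest-below (J? 0) a 2≤a (J-side 0)
      = ⊥-elim (ℕ.<⇒≱ too-many (chords-≤ N K K? (λ x _ → inj₁ (J-side x)) K-noncrossing chords-unique chords))
      where
      K : ℕ → ℕ → Set
      K x y = J x y ⊎ (x ≡ g × y ≡ a)
      K? : ∀ x y → Dec (K x y)
      K? x y = J? x y ⊎-dec ((x ℕ.≟ g) ×-dec (y ℕ.≟ a))
      ¬Jga : ¬ J g a
      ¬Jga Jga = none (g , g<a , 0<g , J0g , Jga)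
      -- A segment crossing `{g, a}` crosses `{0, a}` or `{0, g}` too, or joins 0 to a vertex
      -- strictly between `g` and `a`, against the choice of `g`.
      K-noncrossing : ∀ {x y x′ y′} → x ℕ.< y → y ℕ.< x′ → x′ ℕ.< y′ → y′ ℕ.≤ N → K x x′ → ¬ K y y′
      K-noncrossing l₁ l₂ l₃ l₄ (inj₁ k) (inj₁ k′) = J-noncrossing-window l₁ l₂ l₃ l₄ k k′
      K-noncrossing l₁ l₂ l₃ l₄ (inj₂ (refl , refl)) (inj₁ k′) =
        J-noncrossing-window (ℕ.<-trans 0<g l₁) l₂ l₃ l₄ J0a k′
      K-noncrossing {zero} l₁ l₂ l₃ l₄ (inj₁ k) (inj₂ (refl , refl)) = max l₂ l₃ k
      K-noncrossing {suc x} l₁ l₂ l₃ l₄ (inj₁ k) (inj₂ (refl , refl)) =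
        J-noncrossing-window (s≤s z≤n) l₁ l₂ (ℕ.≤-trans (ℕ.<⇒≤ l₃) l₄) J0g k
      K-noncrossing l₁ l₂ l₃ l₄ (inj₂ (refl , refl)) (inj₂ (refl , _)) = ℕ.<-irrefl refl l₁
      all-chords : List (ℕ × ℕ)
      -- The base edge counts as a chord in `chords-≤`; with it and `{g, a}` the n - 3 diagonals
      -- give `N` chords, one too many.
      all-chords = (g , a) ∷ (0 , N) ∷ positions
      chords-unique : Unique all-chords
      chords-unique =
        ((λ eq → ℕ.<⇒≢ 0<g (sym (proj₁ (,-injective eq)))) ∷
          All.tabulate (λ c∈ eq → ¬Jga (proj₁ (proj₂ (proj₂ (positions-chord (subst (_∈ positions) (sym eq) c∈))))))) ∷
        All.tabulate (λ c∈ eq → proj₂ (proj₂ (proj₂ (positions-chord (subst (_∈ positions) (sym eq) c∈)))) base-side) ∷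
        positions-unique
      chords : All (λ (x , y) → 2 ℕ.+ x ℕ.≤ y × y ℕ.≤ N × K x y) all-chords
      chords =
        (ℕ.≤∧≢⇒< g<a (λ { refl → ¬Jga (J-side g) }) , a≤N , inj₂ (refl , refl)) ∷
        (2≤N , ℕ.≤-refl , inj₁ J-base) ∷
        All.tabulate λ c∈ → let l , h , j , _ = positions-chord c∈ in l , h , inj₁ j
      too-many : N ℕ.∸ 1 ℕ.< length all-chords
      too-many = ℕ.≤-reflexive (sym (≡.begin
        2 ℕ.+ length positions           ≡.≡⟨ cong (2 ℕ.+_) (trans (length-map diagonal-position diagonals) count) ⟩
        2 ℕ.+ (n ℕ.∸ 3)                  ≡.≡⟨ ℕ.+-∸-assoc 2 3≤n ⟨
        (2 ℕ.+ n) ℕ.∸ 3                  ≡.≡⟨⟩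
        N                                ≡.≡⟨ ℕ.m+[n∸m]≡n (ℕ.<⇒≤ 2≤N) ⟨
        suc (N ℕ.∸ 1)                    ≡.∎))

  V-shift : ∀ i b p → At.V (i + + b) p ≡ At.V i (b ℕ.+ p)
  V-shift i b p = cong v (ℤ.+-assoc i (+ b) (+ p))

  -- Rebasing at `v_{i+b}` makes the segment start at 0. The bound `a < b + n` admits segments
  -- running past position n - 1, such as those ending at the second copy `n` of position 0.
  apex : ∀ i {b a} → 2 ℕ.+ b ℕ.≤ a → a ℕ.< b ℕ.+ n → At.J i b a → ∃ λ g → b ℕ.< g × g ℕ.< a × At.J i b g × At.J i g a
  apex i {b} {a} 2+b≤a a<b+n Jba
    with d , refl ← ℕ.m≤n⇒∃[o]m+o≡n (ℕ.<⇒≤ (ℕ.<-trans (ℕ.n<1+n b) 2+b≤a))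
    with g , 0<g , g<d , J0g , Jgd ← At.apex₀ (i + + b)
           (ℕ.+-cancelˡ-≤ b 2 d (subst (ℕ._≤ b ℕ.+ d) (ℕ.+-comm 2 b) 2+b≤a))
           (ℕ.≤-pred (subst (d ℕ.<_) (sym 1+N≡n) (ℕ.+-cancelˡ-< b d n a<b+n)))
           (subst₂ Joined (trans (cong (At.V i) (sym (ℕ.+-identityʳ b))) (sym (V-shift i b 0))) (sym (V-shift i b d)) Jba)
    = b ℕ.+ g , ℕ.m<m+n b 0<g , ℕ.+-monoʳ-< b g<d ,
      subst₂ Joined (trans (V-shift i b 0) (cong (At.V i) (ℕ.+-identityʳ b))) (V-shift i b g) J0g ,
      subst₂ Joined (V-shift i b g) (V-shift i b d) Jgd

-- Cells at a vertex, counted by neighbours.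

module _ {n : ℕ} where

  Increasing : Fin n × Fin n × Fin n → Set
  Increasing (x , y , z) = x Fin.< y × y Fin.< z

  -- A cell is stored with increasing residues but read clockwise from a chosen vertex `A`; the
  -- stored triple is one of three rotations of that reading.
  data Rotation (A B C : Fin n) : Fin n × Fin n × Fin n → Set where
    rot₀ : Rotation A B C (A , B , C)
    rot₁ : Rotation A B C (B , C , A)
    rot₂ : Rotation A B C (C , A , B)

  rotation-unique : ∀ {A B C t t′} → Rotation A B C t → Increasing t → Rotation A B C t′ → Increasing t′ → t ≡ t′
  rotation-unique rot₀ _ rot₀ _ = refl
  rotation-unique rot₁ _ rot₁ _ = refl
  rotation-unique rot₂ _ rot₂ _ = refl
  rotation-unique rot₀ (l , m) rot₁ (l′ , m′) = ⊥-elim (ℕ.<-asym l (ℕ.<-trans l′ m′))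
  rotation-unique rot₀ (l , m) rot₂ (l′ , m′) = ⊥-elim (ℕ.<-asym l′ (ℕ.<-trans l m))
  rotation-unique rot₁ (l , m) rot₀ (l′ , m′) = ⊥-elim (ℕ.<-asym l′ (ℕ.<-trans l m))
  rotation-unique rot₁ (l , m) rot₂ (l′ , m′) = ⊥-elim (ℕ.<-asym l (ℕ.<-trans l′ m′))
  rotation-unique rot₂ (l , m) rot₀ (l′ , m′) = ⊥-elim (ℕ.<-asym l (ℕ.<-trans l′ m′))
  rotation-unique rot₂ (l , m) rot₁ (l′ , m′) = ⊥-elim (ℕ.<-asym l′ (ℕ.<-trans l m))

  -- Two orientations of a triangle cannot both be clockwise.
  rotation-orientation : ∀ {A B C t t′} → Rotation A B C t → Increasing t → Rotation A C B t′ → Increasing t′ → ⊥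
  rotation-orientation rot₀ (l , m) rot₀ (l′ , m′) = ℕ.<-asym m m′
  rotation-orientation rot₀ (l , m) rot₁ (l′ , m′) = ℕ.<-asym m l′
  rotation-orientation rot₀ (l , m) rot₂ (l′ , m′) = ℕ.<-asym l l′
  rotation-orientation rot₁ (l , m) rot₀ (l′ , m′) = ℕ.<-asym l m′
  rotation-orientation rot₁ (l , m) rot₁ (l′ , m′) = ℕ.<-asym l l′
  rotation-orientation rot₁ (l , m) rot₂ (l′ , m′) = ℕ.<-asym m m′
  rotation-orientation rot₂ (l , m) rot₀ (l′ , m′) = ℕ.<-asym l l′
  rotation-orientation rot₂ (l , m) rot₁ (l′ , m′) = ℕ.<-asym m m′
  rotation-orientation rot₂ (l , m) rot₂ (l′ , m′) = ℕ.<-asym m l′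

  rotation-vertex : ∀ {A B B′ C C′ t} → Rotation A B C t → Rotation A B′ C′ t → A ≢ B → A ≢ C → B ≡ B′
  rotation-vertex rot₀ rot₀ _   _   = refl
  rotation-vertex rot₁ rot₁ _   _   = refl
  rotation-vertex rot₂ rot₂ _   _   = refl
  rotation-vertex rot₀ rot₁ _   A≢C = ⊥-elim (A≢C refl)
  rotation-vertex rot₀ rot₂ A≢B _   = ⊥-elim (A≢B refl)
  rotation-vertex rot₁ rot₀ A≢B _   = ⊥-elim (A≢B refl)
  rotation-vertex rot₁ rot₂ _   A≢C = ⊥-elim (A≢C refl)
  rotation-vertex rot₂ rot₀ _   A≢C = ⊥-elim (A≢C refl)
  rotation-vertex rot₂ rot₁ A≢B _   = ⊥-elim (A≢B refl)

module CellCount (n : ℕ) .{{_ : NonZero n}} (3≤n : 3 ℕ.≤ n) (𝕋 : Triangulation n) where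
  open Polygon n
  open Residues n
  open Triangulation 𝕋
  open Joins n 3≤n 𝕋

  Triple : Set
  Triple = Fin n × Fin n × Fin n

  CellAt : ℤ → Triple → Set
  CellAt i (x , y , z) = (Increasing (x , y , z) × Cell x y z) × (v i ≡ x ⊎ v i ≡ y ⊎ v i ≡ z)

  -- Isolates the two nested filters behind `quiddity`, whose predicates are local to their
  -- definitions, as a duplicate-free list with a membership criterion.
  cellsAt : ∀ i → ∃ λ xs → quiddity i ≡ length xs × Unique xs × (∀ {t} → t ∈ xs → CellAt i t) × (∀ {t} → CellAt i t → t ∈ xs)
  cellsAt i = filter _ (filter _ (cartesianProduct (allFin n) (cartesianProduct (allFin n) (allFin n)))) , refl ,
    Unique.filter⁺ _ (Unique.filter⁺ _ (Unique.cartesianProduct⁺ (Unique.allFin⁺ n) (Unique.cartesianProduct⁺ (Unique.allFin⁺ n) (Unique.allFin⁺ n)))) ,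
    (λ t∈ → let t∈cells , vertex = ∈-filter⁻ _ t∈ in proj₂ (∈-filter⁻ _ {xs = cartesianProduct (allFin n) (cartesianProduct (allFin n) (allFin n))} t∈cells) , vertex) ,
    λ { {x , y , z} (cell , vertex) → ∈-filter⁺ _ (∈-filter⁺ _ (∈-cartesianProduct⁺ (∈-allFin x) (∈-cartesianProduct⁺ (∈-allFin y) (∈-allFin z))) cell) vertex }

  module _ (i : ℤ) where
    open At i

    toℕ-V-low : ∀ {p} → toℕ (v i) ℕ.+ p ℕ.< n → toℕ (V p) ≡ toℕ (v i) ℕ.+ p
    toℕ-V-low {p} lt = toℕ-v (i /ℕ n) lt (trans (cong (_+ + p) (v-decompose i)) (lemma (+ toℕ (v i)) (+ p) (i /ℕ n) (+ n)))
      where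
      lemma : ∀ u p t n → u + t * n + p ≡ u + p + t * n
      lemma = ℤSolver.solve-∀

    toℕ-V-high : ∀ {p} → p ℕ.< n → n ℕ.≤ toℕ (v i) ℕ.+ p → toℕ (V p) ℕ.+ n ≡ toℕ (v i) ℕ.+ p
    toℕ-V-high {p} p<n n≤ with d , eq ← ℕ.m≤n⇒∃[o]m+o≡n n≤ =
      trans (cong (ℕ._+ n) (toℕ-v (1ℤ + i /ℕ n) d<n (≡.begin
        i + + p                                       ≡.≡⟨ cong (_+ + p) (v-decompose i) ⟩
        + toℕ (v i) + (i /ℕ n) * + n + + p            ≡.≡⟨ lemma (+ toℕ (v i)) (+ p) (i /ℕ n) (+ n) ⟩
        (+ toℕ (v i) + + p) + (i /ℕ n) * + n          ≡.≡⟨ cong (λ x → + x + (i /ℕ n) * + n) eq ⟨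
        (+ n + + d) + (i /ℕ n) * + n                  ≡.≡⟨ lemma′ (+ d) (i /ℕ n) (+ n) ⟩
        + d + (1ℤ + i /ℕ n) * + n                     ≡.∎)))
      (trans (ℕ.+-comm d n) eq)
      where
      lemma : ∀ u p t n → u + t * n + p ≡ u + p + t * n
      lemma = ℤSolver.solve-∀
      lemma′ : ∀ d t n → (n + d) + t * n ≡ d + (1ℤ + t) * n
      lemma′ = ℤSolver.solve-∀
      d<n : d ℕ.< n
      d<n = ℕ.+-cancelˡ-< n d n (subst (ℕ._< n ℕ.+ n) (sym eq) (ℕ.+-mono-< (Fin.toℕ<n (v i)) p<n))

    V-zero : V 0 ≡ v i
    V-zero = cong v (ℤ.+-identityʳ i)

    -- The rotation depends on which of `V p` and `V p′` have passed residue 0: neither, only the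
    -- later one, or both.
    rotation-exists : ∀ {p p′} → 0 ℕ.< p → p ℕ.< p′ → p′ ℕ.< n → ∃ λ t → Rotation (V 0) (V p) (V p′) t × Increasing t
    rotation-exists {p} {p′} 0<p p<p′ p′<n rewrite V-zero with toℕ (v i) ℕ.+ p ℕ.<? n | toℕ (v i) ℕ.+ p′ ℕ.<? n
    ... | yes l | yes l′ = _ , rot₀ ,
      subst (toℕ (v i) ℕ.<_) (sym (toℕ-V-low l)) (ℕ.m<m+n _ 0<p) ,
      subst₂ ℕ._<_ (sym (toℕ-V-low l)) (sym (toℕ-V-low l′)) (ℕ.+-monoʳ-< (toℕ (v i)) p<p′)
    ... | yes l | no h′ = _ , rot₂ ,
      ℕ.+-cancelʳ-< n _ _ (subst (ℕ._< toℕ (v i) ℕ.+ n) (sym (toℕ-V-high p′<n (ℕ.≮⇒≥ h′))) (ℕ.+-monoʳ-< (toℕ (v i)) p′<n)) ,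
      subst (toℕ (v i) ℕ.<_) (sym (toℕ-V-low l)) (ℕ.m<m+n _ 0<p)
    ... | no h | yes l′ = ⊥-elim (h (ℕ.<-trans (ℕ.+-monoʳ-< (toℕ (v i)) p<p′) l′))
    ... | no h | no h′ = _ , rot₁ ,
      ℕ.+-cancelʳ-< n _ _ (subst₂ ℕ._<_ (sym (toℕ-V-high (ℕ.<-trans p<p′ p′<n) (ℕ.≮⇒≥ h))) (sym (toℕ-V-high p′<n (ℕ.≮⇒≥ h′))) (ℕ.+-monoʳ-< (toℕ (v i)) p<p′)) ,
      ℕ.+-cancelʳ-< n _ _ (subst (ℕ._< toℕ (v i) ℕ.+ n) (sym (toℕ-V-high p′<n (ℕ.≮⇒≥ h′))) (ℕ.+-monoʳ-< (toℕ (v i)) p′<n))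

    -- A cell at v_i is recorded by its first other vertex p clockwise from v_i, so that counting
    -- cells becomes counting neighbours.
    record Starts (t : Triple) (p : ℕ) : Set where
      field
        {p′} : ℕ
        0<p : 0 ℕ.< p
        p<p′ : p ℕ.< p′
        p′<n : p′ ℕ.< n
        rotation : Rotation (V 0) (V p) (V p′) t
        increasing : Increasing t
        J0p : J 0 p
        Jpp′ : J p p′
        J0p′ : J 0 p′

    V-n : V n ≡ V 0
    V-n = V-periodic 0

    starts-cell : ∀ {t p} → Starts t p → CellAt i t
    starts-cell {t} {p} S = go rotation increasing
      where
      open Starts S
      go : ∀ {t} → Rotation (V 0) (V p) (V p′) t → Increasing t → CellAt i t
      go rot₀ inc = (inc , J0p , Jpp′ , J0p′) , inj₁ (sym V-zero)
      go rot₁ inc = (inc , Jpp′ , J-sym {0} {p′} J0p′ , J-sym {0} {p} J0p) , inj₂ (inj₂ (sym V-zero))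
      go rot₂ inc = (inc , J-sym {0} {p′} J0p′ , J0p , J-sym {p} {p′} Jpp′) , inj₂ (inj₁ (sym V-zero))

    starts-of-rotation : ∀ {t B C} → Rotation (V 0) B C t → Increasing t →
      Joined (V 0) B → Joined B C → Joined (V 0) C → ∃ (Starts t)
    starts-of-rotation {t} {B} {C} rot inc j₁ j₂ j₃
      with position B | V-position B | position<n B | position C | V-position C | position<n C
    ... | p | refl | p<n | p′ | refl | p′<n with ℕ.<-cmp p p′
    ...   | tri< p<p′ _ _ = p , record
      { 0<p = ℕ.n≢0⇒n>0 λ { refl → proj₁ (distinct rot inc) refl } ; p<p′ = p<p′ ; p′<n = p′<n
      ; rotation = rot ; increasing = inc ; J0p = j₁ ; Jpp′ = j₂ ; J0p′ = j₃ }
      where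
      distinct : ∀ {A B C : Fin n} {t} → Rotation A B C t → Increasing t → A ≢ B × B ≢ C
      distinct rot₀ (l , m) = (λ { refl → ℕ.<-irrefl refl l }) , λ { refl → ℕ.<-irrefl refl m }
      distinct rot₁ (l , m) = (λ { refl → ℕ.<-asym l m }) , λ { refl → ℕ.<-irrefl refl l }
      distinct rot₂ (l , m) = (λ { refl → ℕ.<-irrefl refl m }) , λ { refl → ℕ.<-asym l m }
    ...   | tri≈ _ refl _ = ⊥-elim (degenerate rot inc)
      where
      degenerate : ∀ {A B : Fin n} {t} → Rotation A B B t → Increasing t → ⊥
      degenerate rot₀ (l , m) = ℕ.<-irrefl refl m
      degenerate rot₁ (l , m) = ℕ.<-irrefl refl l
      degenerate rot₂ (l , m) = ℕ.<-asym l m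
    -- With the positions reversed, `V 0`, `V p′`, `V p` would be clockwise as well.
    ...   | tri> _ _ p′<p = ⊥-elim (let t′ , rot′ , inc′ = rotation-exists (ℕ.n≢0⇒n>0 λ { refl → degenerate rot inc }) p′<p p<n
                                      in rotation-orientation rot inc rot′ inc′)
      where
      degenerate : ∀ {A B : Fin n} {t} → Rotation A B A t → Increasing t → ⊥
      degenerate rot₀ (l , m) = ℕ.<-asym l m
      degenerate rot₁ (l , m) = ℕ.<-irrefl refl m
      degenerate rot₂ (l , m) = ℕ.<-irrefl refl l

    cell-starts : ∀ {t} → CellAt i t → ∃ (Starts t)
    cell-starts {x , y , z} ((inc , jxy , jyz , jxz) , inj₁ eq) with refl ← trans V-zero eq =
      starts-of-rotation rot₀ inc jxy jyz jxz
    cell-starts {x , y , z} ((inc , jxy , jyz , jxz) , inj₂ (inj₁ eq)) with refl ← trans V-zero eq =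
      starts-of-rotation rot₂ inc jyz (joined-sym jxz) (joined-sym jxy)
    cell-starts {x , y , z} ((inc , jxy , jyz , jxz) , inj₂ (inj₂ eq)) with refl ← trans V-zero eq =
      starts-of-rotation rot₁ inc (joined-sym jxz) jxy (joined-sym jyz)

    -- The third vertex is the apex of the segment from `p` to `n`, where `n` is `v_i` again after a
    -- full turn.
    starts-exists : ∀ {p} → 0 ℕ.< p → 2 ℕ.+ p ℕ.≤ n → J 0 p → ∃ λ t → Starts t p
    starts-exists {p} 0<p 2+p≤n J0p
      with p′ , p<p′ , p′<n , Jpp′ , Jp′n ← apex i 2+p≤n (ℕ.m<n+m n 0<p) (subst (Joined (V p)) (sym V-n) (J-sym {0} {p} J0p))
      with t , rot , inc ← rotation-exists 0<p p<p′ p′<n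
      = t , record { 0<p = 0<p ; p<p′ = p<p′ ; p′<n = p′<n ; rotation = rot ; increasing = inc
                   ; J0p = J0p ; Jpp′ = Jpp′ ; J0p′ = joined-sym (subst (Joined (V p′)) V-n Jp′n) }

    -- Of two different third vertices, the segment from `p` to the farther one would cross the
    -- segment from the nearer one to `v_i`.
    starts-injective : ∀ {t t′ p} → Starts t p → Starts t′ p → t ≡ t′
    starts-injective {p = p} S S′ with ℕ.<-cmp (Starts.p′ S) (Starts.p′ S′)
    ... | tri< l _ _ = ⊥-elim (J-noncrossing (Starts.p<p′ S) l (Starts.p′<n S′) (ℕ.m<n+m n (Starts.0<p S))
                         (Starts.Jpp′ S′) (subst (Joined _) (sym V-n) (joined-sym (Starts.J0p′ S))))
    ... | tri> _ _ l = ⊥-elim (J-noncrossing (Starts.p<p′ S′) l (Starts.p′<n S) (ℕ.m<n+m n (Starts.0<p S))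
                         (Starts.Jpp′ S) (subst (Joined _) (sym V-n) (joined-sym (Starts.J0p′ S′))))
    ... | tri≈ _ eq _ = rotation-unique (subst (λ p′ → Rotation (V 0) (V p) (V p′) _) eq (Starts.rotation S)) (Starts.increasing S)
                          (Starts.rotation S′) (Starts.increasing S′)

    starts-functional : ∀ {t p p₁} → Starts t p → Starts t p₁ → p ≡ p₁
    starts-functional S S₁ = V-injective (ℕ.<-trans (Starts.p<p′ S) (Starts.p′<n S)) (ℕ.<-trans (Starts.p<p′ S₁) (Starts.p′<n S₁))
      (rotation-vertex (Starts.rotation S) (Starts.rotation S₁)
        (V-distinct (Starts.0<p S) (ℕ.<-trans (Starts.p<p′ S) (Starts.p′<n S)))
        (V-distinct (ℕ.<-trans (Starts.0<p S) (Starts.p<p′ S)) (Starts.p′<n S)))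

    -- Injections both ways. The count stops at position n - 2 because the preceding vertex, at n -
    -- 1, can only be the second neighbour in a cell.
    quiddity-tally : quiddity i ≡ tally (J? 0) 1 (n ℕ.∸ 2)
    quiddity-tally
      with xs , eq , xs-unique , sound , complete ← cellsAt i
      = trans eq (trans (ℕ.≤-antisym
          (length-≤ Starts xs-unique
            (λ t∈ → let p , S = cell-starts (sound t∈) in p , neighbour S , S) starts-injective)
          (length-≤ (λ p t → Starts t p) neighbours-unique
            (λ p∈ → let t , S = start p∈ in t , complete (starts-cell S) , S) starts-functional))
        (trans (length-filter-applyUpTo (J? 0) suc (n ℕ.∸ 2))
          (tally-cong (J? 0 ∘ suc) (J? 0) 0 1 (n ℕ.∸ 2) λ _ _ → (λ x → x) , (λ x → x))))
      where
      neighbours : List ℕ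
      neighbours = filter (J? 0) (applyUpTo suc (n ℕ.∸ 2))
      neighbours-unique : Unique neighbours
      neighbours-unique = Unique.filter⁺ (J? 0) (Unique.applyUpTo⁺₁ suc (n ℕ.∸ 2) λ i<j _ eq → ℕ.<⇒≢ i<j (ℕ.suc-injective eq))
      neighbour : ∀ {t p} → Starts t p → p ∈ neighbours
      neighbour {p = zero} S = ⊥-elim (ℕ.<-irrefl refl (Starts.0<p S))
      neighbour {p = suc p} S = ∈-filter⁺ (J? 0) (∈-applyUpTo⁺ suc
        (ℕ.∸-monoˡ-≤ 2 (ℕ.≤-trans (s≤s (Starts.p<p′ S)) (Starts.p′<n S)))) (Starts.J0p S)
      start : ∀ {p} → p ∈ neighbours → ∃ λ t → Starts t p
      start p∈ with p∈′ , J0p ← ∈-filter⁻ (J? 0) {xs = applyUpTo suc (n ℕ.∸ 2)} p∈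
        with k , k< , refl ← ∈-applyUpTo⁻ suc p∈′
        = starts-exists (s≤s z≤n) (subst (3 ℕ.+ k ℕ.≤_) (ℕ.m+[n∸m]≡n (ℕ.≤-trans (ℕ.n≤1+n 2) 3≤n)) (s≤s (s≤s k<))) J0p

-- Quiddity and descendant degrees as degrees in the window, and transfer of the labelling.

module Degrees (n : ℕ) .{{_ : NonZero n}} (3≤n : 3 ℕ.≤ n) (𝕋 : Triangulation n) (i : ℤ) where
  open Polygon n
  open Triangulation 𝕋
  open Joins n 3≤n 𝕋
  open CellCount n 3≤n 𝕋
  open At i
  open Window N 2≤N J J? (λ p _ → J-side p) J-base J-noncrossing-window
    (λ {b} {a} 2+b≤a a≤N → apex i 2+b≤a (ℕ.<-≤-trans (subst (a ℕ.<_) 1+N≡n (s≤s a≤N)) (ℕ.m≤n+m n b))) public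

  m : ℕ
  m = n ℕ.∸ 3

  3+m≡n : 3 ℕ.+ m ≡ n
  3+m≡n = ℕ.m+[n∸m]≡n 3≤n

  2+m≡N : 2 ℕ.+ m ≡ N
  2+m≡N = cong (ℕ._∸ 1) 3+m≡n

  quiddity-count : ∀ p → quiddityFrom 𝕋 i p ≡ tally (J? p) (suc p) (1 ℕ.+ m)
  quiddity-count p = ≡.begin
    quiddity (i + + p)                               ≡.≡⟨ quiddity-tally (i + + p) ⟩
    tally (At.J? (i + + p) 0) 1 (n ℕ.∸ 2)            ≡.≡⟨ cong (λ x → tally (At.J? (i + + p) 0) 1 (x ℕ.∸ 2)) 3+m≡n ⟨
    tally (At.J? (i + + p) 0) 1 (1 ℕ.+ m)            ≡.≡⟨ tally-cong (At.J? (i + + p) 0) (J? p) 1 (suc p) (1 ℕ.+ m) (λ k _ →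
                                                          subst₂ Joined V0 (Vk k) , subst₂ Joined (sym V0) (sym (Vk k))) ⟩
    tally (J? p) (suc p) (1 ℕ.+ m)                   ≡.∎
    where
    V0 : At.V (i + + p) 0 ≡ V p
    V0 = trans (V-shift i p 0) (cong V (ℕ.+-identityʳ p))
    Vk : ∀ k → At.V (i + + p) (1 ℕ.+ k) ≡ V (suc p ℕ.+ k)
    Vk k = trans (V-shift i p (1 ℕ.+ k)) (cong V (ℕ.+-suc p k))

  tally-wrap : ∀ j k → tally (J? j) n k ≡ leftCount j 0 k
  tally-wrap j k = tally-cong (J? j) (λ p → J? p j) n 0 k λ t _ →
    (λ jt → joined-sym (subst (Joined (V j)) (wrap t) jt)) ,
    (λ tj → subst (Joined (V j)) (sym (wrap t)) (joined-sym tj))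
    where
    wrap : ∀ t → V (n ℕ.+ t) ≡ V t
    wrap t = trans (cong V (ℕ.+-comm n t)) (V-periodic t)

  -- Dropping the side `{0, 1}` is compensated by adding the base edge `{0, N}`.
  quiddity-first : quiddityFrom 𝕋 i 0 ≡ rightDegree 0
  quiddity-first = ≡.begin
    quiddityFrom 𝕋 i 0               ≡.≡⟨ quiddity-count 0 ⟩
    tally (J? 0) 1 (1 ℕ.+ m)         ≡.≡⟨ tally-first (J? 0) 1 m (J-side 0) ⟩
    suc (tally (J? 0) 2 m)           ≡.≡⟨ tally-last (J? 0) 2 m (subst (J 0) (sym 2+m≡N) J-base) ⟨
    tally (J? 0) 2 (1 ℕ.+ m)         ≡.≡⟨ cong (λ x → tally (J? 0) 2 (x ℕ.∸ 1)) 2+m≡N ⟩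
    rightDegree 0                    ≡.∎

  -- Clockwise from `j` come the side to `j + 1`, which supplies the extra 1, then the right
  -- neighbours up to `N`, and after the turn at `n` the left ones.
  quiddity-inner : ∀ k → suc k ℕ.< N → quiddityFrom 𝕋 i (suc k) ≡ leftDegree (suc k) ℕ.+ suc (rightDegree (suc k))
  quiddity-inner k k<N = ≡.begin
    quiddityFrom 𝕋 i j                                ≡.≡⟨ quiddity-count j ⟩
    tally (J? j) (2 ℕ.+ k) (1 ℕ.+ m)                  ≡.≡⟨ tally-first (J? j) (2 ℕ.+ k) m (J-side j) ⟩
    suc (tally (J? j) (3 ℕ.+ k) m)                    ≡.≡⟨ cong (λ x → suc (tally (J? j) (3 ℕ.+ k) x)) (ℕ.m∸n+n≡m k≤m) ⟨
    suc (tally (J? j) (3 ℕ.+ k) (m ℕ.∸ k ℕ.+ k))      ≡.≡⟨ cong suc (tally-+ (J? j) (3 ℕ.+ k) (m ℕ.∸ k) k) ⟩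
    suc (tally (J? j) (3 ℕ.+ k) (m ℕ.∸ k) ℕ.+ tally (J? j) (3 ℕ.+ k ℕ.+ (m ℕ.∸ k)) k)
      ≡.≡⟨ cong₂ (λ x y → suc (tally (J? j) (3 ℕ.+ k) (x ℕ.∸ (2 ℕ.+ k)) ℕ.+ tally (J? j) y k))
           2+m≡N (trans (cong (3 ℕ.+_) (ℕ.m+[n∸m]≡n k≤m)) 3+m≡n) ⟩
    suc (rightDegree j ℕ.+ tally (J? j) n k)          ≡.≡⟨ cong (λ x → suc (rightDegree j ℕ.+ x)) (tally-wrap j k) ⟩
    suc (rightDegree j) ℕ.+ leftDegree j              ≡.≡⟨ ℕ.+-comm (suc (rightDegree j)) (leftDegree j) ⟩
    leftDegree j ℕ.+ suc (rightDegree j)              ≡.∎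
    where
    j = suc k
    k≤m : k ℕ.≤ m
    k≤m = ℕ.≤-pred (ℕ.≤-pred (subst (2 ℕ.+ k ℕ.≤_) (sym 2+m≡N) k<N))

  quiddity-last : quiddityFrom 𝕋 i N ≡ leftDegree N
  quiddity-last = ≡.begin
    quiddityFrom 𝕋 i N                    ≡.≡⟨ quiddity-count N ⟩
    tally (J? N) (suc N) (1 ℕ.+ m)        ≡.≡⟨ cong₂ (λ x y → tally (J? N) x (y ℕ.∸ 1)) 1+N≡n 2+m≡N ⟩
    tally (J? N) n (N ℕ.∸ 1)              ≡.≡⟨ tally-wrap N (N ℕ.∸ 1) ⟩
    leftDegree N                          ≡.∎

  descendants : ℕ → ℕ
  descendants p = descendantDegree i (i + + p)

  -- The interval from `i` to `i − 2` has computed length -1, which is truncated to 0.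
  descendants-first : descendants 0 ≡ 0
  descendants-first = cong (λ x → length (filter (λ α → diagonal? (v (i + + 0)) (v α)) (map (λ k → i + + k) (upTo ∣ 0ℤ ⊔ x ∣)))) (lemma i)
    where
    lemma : ∀ i → i + + 0 - + 2 - i + 1ℤ ≡ -1ℤ
    lemma = ℤSolver.solve-∀

  descendants-tally : ∀ k → descendants (suc k) ≡ tally (λ t → diagonal? (V (suc k)) (V t)) 0 k
  descendants-tally k = ≡.begin
    length (filter D? [ i ⋯ i + + suc k - + 2 ])          ≡.≡⟨ cong (length ∘ filter D?) (⋯-upTo i (i + + suc k - + 2) k (lemma i (+ k))) ⟩
    length (filter D? (map (λ t → i + + t) (upTo k)))     ≡.≡⟨ cong (length ∘ filter D?) (map-upTo (λ t → i + + t) k) ⟩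
    length (filter D? (applyUpTo (λ t → i + + t) k))      ≡.≡⟨ length-filter-applyUpTo D? (λ t → i + + t) k ⟩
    tally (λ t → diagonal? (V (suc k)) (V t)) 0 k         ≡.∎
    where
    D? = λ α → diagonal? (V (suc k)) (v α)
    lemma : ∀ i k → i + (1ℤ + k) - + 2 - i + 1ℤ ≡ k
    lemma = ℤSolver.solve-∀

  joined-diagonal : ∀ {t j} → suc t ℕ.< j → suc j ℕ.< t ℕ.+ n → Joined (V t) (V j) → Diagonal (V j) (V t)
  joined-diagonal l h (inj₂ δ) = swap δ
  joined-diagonal l h (inj₁ s) with side-cases (ℕ.<-trans (ℕ.n<1+n _) l) (ℕ.<-trans (ℕ.n<1+n _) h) s
  ... | inj₁ eq = ⊥-elim (ℕ.<⇒≢ l (sym eq))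
  ... | inj₂ eq = ⊥-elim (ℕ.<⇒≢ h eq)

  descendants-inner : ∀ k → suc k ℕ.< N → descendants (suc k) ≡ leftDegree (suc k)
  descendants-inner k k<N = trans (descendants-tally k) (tally-cong _ _ 0 0 k λ t t<k →
    (λ δ → inj₂ (swap δ)) , joined-diagonal (s≤s t<k) (ℕ.<-≤-trans (subst (2 ℕ.+ k ℕ.<_) 1+N≡n (s≤s k<N)) (ℕ.m≤n+m n t)))

  -- The neighbour 0 drops out: it is reached by the base edge, which is a side and not a diagonal.
  descendants-last : descendants N ≡ leftDegree N ℕ.∸ 1
  descendants-last = subst (λ j → descendants j ≡ leftDegree j ℕ.∸ 1) 2+m≡N (≡.begin
    descendants j                              ≡.≡⟨ descendants-tally (1 ℕ.+ m) ⟩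
    tally D? 0 (1 ℕ.+ m)                       ≡.≡⟨ tally-+ D? 0 1 m ⟩
    tally D? 0 1 ℕ.+ tally D? 1 m              ≡.≡⟨ cong (ℕ._+ tally D? 1 m) (tally-none D? 0 1 λ { zero _ _ → diagonal-not-side (subst (λ x → Side (V x) (V 0)) (sym 2+m≡N) (side-sym base-side)) ; (suc _) _ (s≤s ()) }) ⟩
    tally D? 1 m                               ≡.≡⟨ tally-cong D? (λ p → J? p j) 1 1 m (λ t t<m →
                                                    (λ δ → inj₂ (swap δ)) ,
                                                    joined-diagonal (s≤s (s≤s t<m)) (subst (λ x → 3 ℕ.+ m ℕ.< 1 ℕ.+ t ℕ.+ x) 3+m≡n (s≤s (ℕ.m≤n+m (3 ℕ.+ m) t)))) ⟩
    leftCount j 1 m                            ≡.≡⟨ cong (ℕ._∸ 1) (tally-first (λ p → J? p j) 0 m (subst (J 0) (sym 2+m≡N) J-base)) ⟨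
    leftDegree j ℕ.∸ 1                         ≡.∎)
    where
    j = 2 ℕ.+ m
    D? = λ t → diagonal? (V j) (V t)

  quiddity-nonZeroDivisor : ∀ p → p ℕ.≤ N → 1 ℕ.≤ p → NonZeroDivisor (continuant (quiddityFrom 𝕋 i) p)
  quiddity-nonZeroDivisor = continuant-nonZeroDivisor (quiddityFrom 𝕋 i) descendants
    quiddity-first quiddity-inner quiddity-last descendants-first descendants-inner descendants-last

  module _ {w : ℤ → ℤ → ℤ} {r s : ℤ → Poly} (F : IsFareyLabeling 𝕋 i w r s) where
    open IsFareyLabeling F

    last≡ : i + + n - 1ℤ ≡ i + + N
    last≡ = trans (cong (λ x → i + + x - 1ℤ) (sym 1+N≡n)) (lemma i (+ N))
      where
      lemma : ∀ i k → i + (1ℤ + k) - 1ℤ ≡ i + k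
      lemma = ℤSolver.solve-∀

    ShiftedWeight : ℕ → ℕ → ℕ → Set
    ShiftedWeight b a x = w (i + + b) (i + + a) ≡ + x - 1ℤ

    shiftedWeight-functional : ∀ {b a x y} → ShiftedWeight b a x → ShiftedWeight b a y → x ≡ y
    shiftedWeight-functional {x = x} {y} e e′ = ℤ.+-injective
      (trans (lemma (+ x)) (trans (cong (_+ 1ℤ) (trans (sym e) e′)) (sym (lemma (+ y)))))
      where
      lemma : ∀ k → k ≡ k - 1ℤ + 1ℤ
      lemma = ℤSolver.solve-∀

    shiftedWeight-base : ShiftedWeight 0 N 0
    shiftedWeight-base = trans (cong₂ w (ℤ.+-identityʳ i) (sym last≡)) base-weight

    cell-at : ∀ {b g a x} → b ℕ.< g → g ℕ.< a → a ℕ.≤ N → J b g → J g a → J b a → ShiftedWeight b a x →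
        r (i + + g) ≈ r (i + + a) ⊕ q^ x ⊗ r (i + + b)
      × s (i + + g) ≈ s (i + + a) ⊕ q^ x ⊗ s (i + + b)
      × w (i + + g) (i + + a) ≡ 0ℤ × w (i + + b) (i + + g) ≡ + x
    cell-at {b} {g} {a} {x} b<g g<a a≤N Jbg Jga Jba W =
      cell (i + + b) (i + + g) (i + + a) x (ℤ.i≤i+j i (+ b)) (ℤ.+-monoʳ-< i (ℤ.+<+ b<g)) (ℤ.+-monoʳ-< i (ℤ.+<+ g<a))
        (subst (i + + a ≤_) (sym last≡) (ℤ.+-monoʳ-≤ i (ℤ.+≤+ a≤N))) (Jbg , Jga , Jba) W

    numerators : Labelling ShiftedWeight (λ p → r (i + + p))
    numerators = record { base = shiftedWeight-base ; cell = λ b<g g<a a≤N Jbg Jga Jba W →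
      let er , es , e₁ , e₂ = cell-at b<g g<a a≤N Jbg Jga Jba W in er , e₁ , e₂ }

    denominators : Labelling ShiftedWeight (λ p → s (i + + p))
    denominators = record { base = shiftedWeight-base ; cell = λ b<g g<a a≤N Jbg Jga Jba W →
      let er , es , e₁ , e₂ = cell-at b<g g<a a≤N Jbg Jga Jba W in es , e₁ , e₂ }

    at-first : ∀ (t : ℤ → Poly) {p} → t i ≈ p → t (i + + 0) ≈ p
    at-first t = ≈-trans (≈-reflexive (cong t (ℤ.+-identityʳ i)))

    at-last : ∀ (t : ℤ → Poly) {p} → t (i + + n - 1ℤ) ≈ p → t (i + + N) ≈ p
    at-last t = ≈-trans (≈-reflexive (cong t (sym last≡)))

    wraps : r (i + + suc N) ≈ -1ℤ · r (i + + 0) × s (i + + suc N) ≈ -1ℤ · s (i + + 0)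
    wraps = let er , es = antiperiodic i 1ℤ ℤ.≤-refl (ℤ.≤-trans (ℤ.i≤i+j i (+ N)) (ℤ.≤-reflexive (sym last≡))) in at-n r er , at-n s es
      where
      at-n : ∀ (t : ℤ → Poly) → t (i + 1ℤ * + n) ≈ -1ℤ · t i → t (i + + suc N) ≈ -1ℤ · t (i + + 0)
      at-n t e = ≈-trans (≈-reflexive (cong (λ x → t (i + x)) (trans (cong +_ 1+N≡n) (sym (ℤ.*-identityˡ (+ n))))))
        (≈-trans e (≈-reflexive (cong (λ x → -1ℤ · t x) (sym (ℤ.+-identityʳ i)))))

    module _ {Λ : ℕ → ℕ} (Λ-start : Λ 0 ≡ 0) (Λ-step : ∀ p → p ℕ.≤ N → Λ (suc p) ≡ Λ p ℕ.+ descendants p) where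

      numerator : ∀ p → p ℕ.≤ suc N → q^ Λ p ⊗ r (i + + p) ≈ continuant (quiddityFrom 𝕋 (i - 1ℤ)) (suc p)
      numerator = numerator-continuant numerators shiftedWeight-functional (quiddityFrom 𝕋 i) descendants Λ
        quiddity-first quiddity-inner quiddity-last descendants-first descendants-inner descendants-last Λ-start Λ-step
        (quiddityFrom 𝕋 (i - 1ℤ)) (λ k → cong quiddity (lemma i (+ k)))
        (at-first r r-first) (at-last r r-last) (proj₁ wraps)
        where
        lemma : ∀ i k → i - 1ℤ + (1ℤ + k) ≡ i + k
        lemma = ℤSolver.solve-∀

      denominator : ∀ p → p ℕ.≤ suc N → q^ Λ p ⊗ s (i + + p) ≈ continuant (quiddityFrom 𝕋 i) p
      denominator = denominator-continuant denominators shiftedWeight-functional (quiddityFrom 𝕋 i) descendants Λ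
        quiddity-first quiddity-inner quiddity-last descendants-first descendants-inner descendants-last Λ-start Λ-step
        (at-first s s-first) (at-last s s-last) (proj₂ wraps)

-- Matching the indices of frieze, labels and degree sums.

theorem3p15 : ∀ (n : ℕ) .{{_ : NonZero n}} → 3 ℕ.≤ n → (𝕋 : Triangulation n) (i : ℤ)
    (ζ : ℤ → ℤ → Poly) → IsFrieze 𝕋 ζ →
    (w : ℤ → ℤ → ℤ) (r s : ℤ → Poly) → IsFareyLabeling 𝕋 i w r s →
    (ℓ : ℤ → ℕ) → IsDegreeSum 𝕋 i ℓ →
    (∀ (j : ℤ) → i - 1ℤ ≤ j → j ≤ i + + n - 1ℤ →
    ζ (i - 1ℤ) (j + 1ℤ) ≈ q^ (ℓ j) ⊗ r (j + 1ℤ)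
    × ζ i (j + 1ℤ) ≈ q^ (ℓ j) ⊗ s (j + 1ℤ))
    × (ℓ i ≡ 0 × ℓ (i + 1ℤ) ≡ 0)
    × (Triangulation.descendantDegree 𝕋 i i ≡ 0 × Triangulation.descendantDegree 𝕋 i (i + 1ℤ) ≡ 0)
theorem3p15 n 3≤n 𝕋 i ζ frieze w r s farey ℓ degreeSum =
  labels , (trans (cong ℓ (lemma₁ i)) Λ1≡0 , trans (cong ℓ (lemma₂ i)) Λ2≡0) ,
  (trans (cong (Triangulation.descendantDegree 𝕋 i) (sym (ℤ.+-identityʳ i))) descendants-first , descendants1≡0)
  where
  open Degrees n 3≤n 𝕋 i using (descendants; descendants-first; descendants-inner; numerator; denominator; last≡)
  open Joins n 3≤n 𝕋 using (N; 2≤N; 1+N≡n)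
  open IsDegreeSum degreeSum
  Λ : ℕ → ℕ
  Λ p = ℓ (i - 1ℤ + + p)
  Λ-start : Λ 0 ≡ 0
  Λ-start = trans (cong ℓ (ℤ.+-identityʳ (i - 1ℤ))) start
  Λ-step : ∀ p → p ℕ.≤ N → Λ (suc p) ≡ Λ p ℕ.+ descendants p
  Λ-step p p≤N = trans (cong ℓ (lemma i (+ p)))
    (trans (step (i + + p) (ℤ.i≤i+j i (+ p)) (ℤ.≤-trans (ℤ.+-monoʳ-≤ i (ℤ.+≤+ p≤N)) (ℤ.≤-reflexive (sym (last≡ farey)))))
      (cong (λ x → ℓ x ℕ.+ descendants p) (lemma′ i (+ p))))
    where
    lemma : ∀ i p → i - 1ℤ + (1ℤ + p) ≡ i + p
    lemma = ℤSolver.solve-∀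
    lemma′ : ∀ i p → i + p - 1ℤ ≡ i - 1ℤ + p
    lemma′ = ℤSolver.solve-∀
  lemma₁ : ∀ i → i ≡ i - 1ℤ + 1ℤ
  lemma₁ = ℤSolver.solve-∀
  lemma₂ : ∀ i → i + 1ℤ ≡ i - 1ℤ + + 2
  lemma₂ = ℤSolver.solve-∀
  descendants1≡0 : descendants 1 ≡ 0
  descendants1≡0 = descendants-inner 0 2≤N
  Λ1≡0 : Λ 1 ≡ 0
  Λ1≡0 = trans (Λ-step 0 z≤n) (cong₂ ℕ._+_ Λ-start descendants-first)
  Λ2≡0 : Λ 2 ≡ 0
  Λ2≡0 = trans (Λ-step 1 (ℕ.<⇒≤ 2≤N)) (cong₂ ℕ._+_ Λ1≡0 descendants1≡0)
  ζ-continuant : ∀ p → p ℕ.≤ suc n → ∀ k → ζ k (k + + p) ≈ continuant (quiddityFrom 𝕋 k) p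
  ζ-continuant = frieze-continuant 𝕋 frieze λ k p p<n 1≤p → Degrees.quiddity-nonZeroDivisor n 3≤n 𝕋 k p (ℕ.≤-pred (subst (p ℕ.<_) (sym 1+N≡n) p<n)) 1≤p
  -- Here `p = j − (i − 1)` runs from 0 to n. Numerators are compared in row `p + 1` and
  -- denominators in row `p`, so both stay within the n + 1 rows of the frieze.
  labels-at : ∀ p → p ℕ.≤ n →
    ζ (i - 1ℤ) (i - 1ℤ + + p + 1ℤ) ≈ q^ Λ p ⊗ r (i - 1ℤ + + p + 1ℤ) ×
    ζ i (i - 1ℤ + + p + 1ℤ) ≈ q^ Λ p ⊗ s (i - 1ℤ + + p + 1ℤ)
  labels-at p p≤n =
    ≈-trans (≈-reflexive (cong (ζ (i - 1ℤ)) (lemma i (+ p))))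
      (≈-trans (ζ-continuant (suc p) (s≤s p≤n) (i - 1ℤ))
        (≈-trans (≈-sym (numerator farey Λ-start Λ-step p (subst (p ℕ.≤_) (sym 1+N≡n) p≤n))) (≈-reflexive (cong (λ x → q^ Λ p ⊗ r x) (sym (lemma′ i (+ p))))))) ,
    ≈-trans (≈-reflexive (cong (ζ i) (lemma′ i (+ p))))
      (≈-trans (ζ-continuant p (ℕ.≤-trans p≤n (ℕ.n≤1+n n)) i)
        (≈-trans (≈-sym (denominator farey Λ-start Λ-step p (subst (p ℕ.≤_) (sym 1+N≡n) p≤n))) (≈-reflexive (cong (λ x → q^ Λ p ⊗ s x) (sym (lemma′ i (+ p)))))))
    where
    lemma : ∀ i p → i - 1ℤ + p + 1ℤ ≡ i - 1ℤ + (1ℤ + p)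
    lemma = ℤSolver.solve-∀
    lemma′ : ∀ i p → i - 1ℤ + p + 1ℤ ≡ i + p
    lemma′ = ℤSolver.solve-∀
  labels : ∀ j → i - 1ℤ ≤ j → j ≤ i + + n - 1ℤ →
    ζ (i - 1ℤ) (j + 1ℤ) ≈ q^ (ℓ j) ⊗ r (j + 1ℤ) × ζ i (j + 1ℤ) ≈ q^ (ℓ j) ⊗ s (j + 1ℤ)
  labels j lo hi = subst (λ j → ζ (i - 1ℤ) (j + 1ℤ) ≈ q^ (ℓ j) ⊗ r (j + 1ℤ) × ζ i (j + 1ℤ) ≈ q^ (ℓ j) ⊗ s (j + 1ℤ))
    j≡ (labels-at p p≤n)
    where
    p = ∣ j - (i - 1ℤ) ∣
    +p≡ : + p ≡ j - (i - 1ℤ)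
    +p≡ = ℤ.0≤i⇒+∣i∣≡i (ℤ.i≤j⇒0≤j-i lo)
    lemma : ∀ i j → i - 1ℤ + (j - (i - 1ℤ)) ≡ j
    lemma = ℤSolver.solve-∀
    lemma′ : ∀ i n → i + n - 1ℤ - (i - 1ℤ) ≡ n
    lemma′ = ℤSolver.solve-∀
    j≡ : i - 1ℤ + + p ≡ j
    j≡ = trans (cong (_+_ (i - 1ℤ)) +p≡) (lemma i j)
    p≤n : p ℕ.≤ n
    p≤n = ℤ.drop‿+≤+ (subst₂ _≤_ (sym +p≡) (lemma′ i (+ n)) (ℤ.+-monoˡ-≤ (- (i - 1ℤ)) hi))
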